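{- Let $A(N)$ denote the number of generalised Petersen graphs $P(n,k)$, up to isomorphism, that have $n \leq N$, and let $B(N)$ denote the number of those (up to isomorphism) that are also Cayley graphs. Then $$\lim_{N \rightarrow \infty} \frac{B(N)}{A(N)} = 0.$$
   Context: For positive integers $n \geq 3$ and $k \leq n/2$, the generalised Petersen graph $P(n,k)$ is the graph with vertex set $\{a_i, b_i : 0 \leq i \leq n-1\}$ (so $2n$ vertices) and edges $a_i a_{i+1}$, $a_i b_i$, $b_i b_{i+k}$ for $0 \leq i \leq n-1$, with subscripts read modulo $n$. When $k=n/2$, the edges $b_ib_{i+k}$ and $b_{i+k}b_{i+2k}=b_{i+k}b_i$ are counted separately, so that $b_i$ and $b_{i+k}$ are joined by a double edge. With this convention $P(n,k)$ is always connected and cubic ($3$-regular). A graph is a Cayley graph if it is isomorphic to the (simple, undirected) graph $X(G,S)$ with vertex set a group $G$ and edges $\{g,gs\}$ for $g \in G$, $s \in S$, for some group $G$ and some symmetric subset $S=S^{ -1}$ of $G$ with $1 \notin S$. -}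

module Defs where

open import Level using (0ℓ)
open import Algebra.Bundles using (Group)
open import Data.Fin.Base as Fin
  using (Fin; toℕ; finToFun; funToFin; combine; remQuot; splitAt; join)
open import Data.Fin.Properties as Fin
  using (nonZeroIndex; any?; all?; finToFun-funToFin; remQuot-combine; splitAt-join)
open import Data.List.Base using (List; length; filter; deduplicate; upTo; cartesianProduct)
open import Data.Nat.Base using (ℕ; suc; _+_; _*_; _^_; _≤_)
open import Data.Nat.DivMod using (_mod_)
open import Data.Nat.Properties using (_≤?_)
open import Data.Product.Base using (Σ-syntax; ∃; ∃-syntax; _×_; _,_; proj₁; proj₂)
open import Data.Product.Relation.Binary.Pointwise.NonDependent using (_×ₛ_)
open import Data.Sum.Base as Sum using (_⊎_; inj₁; inj₂)
open import Function.Base using (_∘_)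
open import Function.Bundles using (Func; Inverse)
open import Relation.Binary.Bundles using (Setoid)
open import Relation.Binary.Definitions using (_Respects_) renaming (Decidable to Decidable₂)
open import Relation.Binary.PropositionalEquality
  using (_≡_; refl; sym; trans; cong; cong₂; subst; setoid; isEquivalence; _→-setoid_; module ≡-Reasoning)
import Relation.Binary.Construct.On as On
import Relation.Binary.Reasoning.Setoid as SetoidReasoning
open import Relation.Nullary using (¬_; Dec; ¬?; map′; _×-dec_; _⊎-dec_; _→-dec_)
open import Relation.Unary using (Pred; Decidable)

Unordered : Setoid 0ℓ 0ℓ → Setoid 0ℓ 0ℓ
Unordered V = record
  { Carrier       = Carrier × Carrier
  ; _≈_           = λ (x , y) (u , v) → (x ≈ u × y ≈ v) ⊎ (x ≈ v × y ≈ u)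
  ; isEquivalence = record
    { refl  = inj₁ (V.refl , V.refl)
    ; sym   = λ where
        (inj₁ (p , q)) → inj₁ (V.sym p , V.sym q)
        (inj₂ (p , q)) → inj₂ (V.sym q , V.sym p)
    ; trans = λ where
        (inj₁ (p , q)) (inj₁ (r , s)) → inj₁ (V.trans p r , V.trans q s)
        (inj₁ (p , q)) (inj₂ (r , s)) → inj₂ (V.trans p r , V.trans q s)
        (inj₂ (p , q)) (inj₁ (r , s)) → inj₂ (V.trans p s , V.trans q r)
        (inj₂ (p , q)) (inj₂ (r , s)) → inj₁ (V.trans p s , V.trans q r)
    }
  }
  where module V = Setoid V
        open V using (Carrier; _≈_)

-- Edges are objects in their own right, so several edges may join the
-- same two vertices.  Vertices and edges are setoids so that the vertex
-- set of a Cayley graph may be the carrier of an arbitrary `Group`.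
record Multigraph : Set₁ where
  field
    Vertices : Setoid 0ℓ 0ℓ
    Edges    : Setoid 0ℓ 0ℓ
    ends     : Func Edges (Unordered Vertices)

infix 4 _≅_

record _≅_ (M M′ : Multigraph) : Set where
  private
    module M  = Multigraph M
    module M′ = Multigraph M′
  open Setoid (Unordered M′.Vertices) using (_≈_)
  field
    vertices : Inverse M.Vertices M′.Vertices
    edges    : Inverse M.Edges M′.Edges
  private
    φ = Inverse.to vertices
    ψ = Inverse.to edges
  field
    preserves-ends : ∀ e → let (u , v) = Func.to M.ends e in
                     (φ u , φ v) ≈ Func.to M′.ends (ψ e)

discrete : (V E : Set) → (E → V × V) → Multigraph
discrete V E ends = record
  { Vertices = setoid V
  ; Edges    = setoid E
  ; ends     = record { to = ends ; cong = λ { refl → inj₁ (refl , refl) } }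
  }

pattern a i = inj₁ i
pattern b i = inj₂ i

pattern rim i   = inj₁ i
pattern spoke i = inj₂ (inj₁ i)
pattern inner i = inj₂ (inj₂ i)

infixl 6 _⊕_

_⊕_ : ∀ {n} → Fin n → ℕ → Fin n
_⊕_ {n} i k = ((toℕ i + k) mod n) {{nonZeroIndex i}}

petersenEnds : ∀ n → ℕ → Fin n ⊎ Fin n ⊎ Fin n → (Fin n ⊎ Fin n) × (Fin n ⊎ Fin n)
petersenEnds n k (rim i)   = a i , a (i ⊕ 1)
petersenEnds n k (spoke i) = a i , b i
petersenEnds n k (inner i) = b i , b (i ⊕ k)

-- When 2k = n, the edges `inner i` and `inner (i ⊕ k)` are distinct but
-- have the same ends: this is the double edge between b i and b (i ⊕ k).
P : ℕ → ℕ → Multigraph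
P n k = discrete (Fin n ⊎ Fin n) (Fin n ⊎ Fin n ⊎ Fin n) (petersenEnds n k)

record ConnectionSet (G : Group 0ℓ 0ℓ) : Set₁ where
  open Group G
  field
    S         : Pred Carrier 0ℓ
    resp      : S Respects _≈_
    symmetric : ∀ {s} → S s → S (s ⁻¹)
    ε∉S       : ¬ S ε

-- An edge is presented by g and s ∈ S, and two presentations are equal
-- when the sets {g , gs} are equal; hence there are no multiple edges.
X : (G : Group 0ℓ 0ℓ) → ConnectionSet G → Multigraph
X G C = record
  { Vertices = Group.setoid G
  ; Edges    = On.setoid (Unordered (Group.setoid G)) pair
  ; ends     = record { to = pair ; cong = λ p → p }
  }
  where
  open Group G using (Carrier; _∙_)
  open ConnectionSet C
  pair : Carrier × ∃ S → Carrier × Carrier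
  pair (g , s , _) = g , g ∙ s

IsCayley : Multigraph → Set₁
IsCayley M = Σ[ G ∈ Group 0ℓ 0ℓ ] Σ[ C ∈ ConnectionSet G ] M ≅ X G C

record Finite (A : Setoid 0ℓ 0ℓ) : Set where
  open Setoid A
  field
    size     : ℕ
    enum     : Fin size → Carrier
    idx      : Carrier → Fin size
    enum-idx : ∀ x → enum (idx x) ≈ x

module _ {A : Setoid 0ℓ 0ℓ} (fin : Finite A) {ℓ} {Q : Pred (Setoid.Carrier A) ℓ}
         (resp : Q Respects Setoid._≈_ A) (Q? : Decidable Q) where
  open Setoid A using () renaming (sym to ≈-sym)
  open Finite fin

  ∃? : Dec (∃ Q)
  ∃? = map′ (λ (i , q) → enum i , q)
            (λ (x , q) → idx x , resp (≈-sym (enum-idx x)) q)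
            (any? (Q? ∘ enum))

  ∀? : Dec (∀ x → Q x)
  ∀? = map′ (λ h x → resp (enum-idx x) (h (idx x))) (λ h i → h (enum i))
            (all? (Q? ∘ enum))

FiniteSet : Set → Set
FiniteSet A = Finite (setoid A)

∃?≡ : ∀ {A} → FiniteSet A → ∀ {ℓ} {Q : Pred A ℓ} → Decidable Q → Dec (∃ Q)
∃?≡ fin {Q = Q} = ∃? fin (subst Q)

∀?≡ : ∀ {A} → FiniteSet A → ∀ {ℓ} {Q : Pred A ℓ} → Decidable Q → Dec (∀ x → Q x)
∀?≡ fin {Q = Q} = ∀? fin (subst Q)

≡? : ∀ {A} → FiniteSet A → Decidable₂ (_≡_ {A = A})
≡? fin x y = map′ (λ p → trans (sym (enum-idx x)) (trans (cong enum p) (enum-idx y)))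
                  (cong idx) (idx x Fin.≟ idx y)
  where open Finite fin

Fin-finite : ∀ {n} → FiniteSet (Fin n)
Fin-finite {n} = record { size = n ; enum = λ i → i ; idx = λ i → i ; enum-idx = λ _ → refl }

⊎-finite : ∀ {A B} → FiniteSet A → FiniteSet B → FiniteSet (A ⊎ B)
⊎-finite {A} {B} α β = record
  { size     = α.size + β.size
  ; enum     = Sum.map α.enum β.enum ∘ splitAt α.size
  ; idx      = join α.size β.size ∘ Sum.map α.idx β.idx
  ; enum-idx = λ x → trans
      (cong (Sum.map α.enum β.enum) (splitAt-join α.size β.size (Sum.map α.idx β.idx x)))
      (pointwise x)
  }
  where
  module α = Finite α
  module β = Finite β
  pointwise : ∀ x → Sum.map α.enum β.enum (Sum.map α.idx β.idx x) ≡ x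
  pointwise (inj₁ x) = cong inj₁ (α.enum-idx x)
  pointwise (inj₂ y) = cong inj₂ (β.enum-idx y)

×-finite : ∀ {A B} → Finite A → Finite B → Finite (A ×ₛ B)
×-finite {A} {B} α β = record
  { size     = α.size * β.size
  ; enum     = λ i → let (j , k) = remQuot β.size i in α.enum j , β.enum k
  ; idx      = λ (x , y) → combine (α.idx x) (β.idx y)
  ; enum-idx = λ (x , y) → let eq = remQuot-combine (α.idx x) (β.idx y) in
        A.trans (A.reflexive (cong (α.enum ∘ proj₁) eq)) (α.enum-idx x)
      , B.trans (B.reflexive (cong (β.enum ∘ proj₂) eq)) (β.enum-idx y)
  }
  where
  module A = Setoid A
  module B = Setoid B
  module α = Finite α
  module β = Finite β

→-finite : ∀ {A B} → FiniteSet A → FiniteSet B → Finite (A →-setoid B)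
→-finite {A} {B} α β = record
  { size     = β.size ^ α.size
  ; enum     = λ i x → β.enum (finToFun i (α.idx x))
  ; idx      = λ f → funToFin (code f)
  ; enum-idx = λ f x → begin
      β.enum (finToFun (funToFin (code f)) (α.idx x)) ≡⟨ cong β.enum (finToFun-funToFin (code f) (α.idx x)) ⟩
      β.enum (code f (α.idx x))                       ≡⟨ β.enum-idx _ ⟩
      f (α.enum (α.idx x))                            ≡⟨ cong f (α.enum-idx x) ⟩
      f x                                             ∎
  }
  where
  open ≡-Reasoning
  module α = Finite α
  module β = Finite β
  code : (A → B) → Fin α.size → Fin β.size
  code f i = β.idx (f (α.enum i))

×-finite≡ : ∀ {A B} → FiniteSet A → FiniteSet B → FiniteSet (A × B)
×-finite≡ α β = record
  { size = size ; enum = enum ; idx = idx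
  ; enum-idx = λ x → let (p , q) = enum-idx x in cong₂ _,_ p q }
  where open Finite (×-finite α β)

module _ {V : Set} where
  infix 4 _≈ᵤ_

  _≈ᵤ_ : V × V → V × V → Set
  _≈ᵤ_ = Setoid._≈_ (Unordered (setoid V))

  ≈ᵤ? : FiniteSet V → Decidable₂ _≈ᵤ_
  ≈ᵤ? fin (x , y) (u , v) =
    (≡? fin x u ×-dec ≡? fin y v) ⊎-dec (≡? fin x v ×-dec ≡? fin y u)

module IsoDecision
  {V E V′ E′ : Set} (finV : FiniteSet V) (finE : FiniteSet E)
  (finV′ : FiniteSet V′) (finE′ : FiniteSet E′)
  (ends : E → V × V) (ends′ : E′ → V′ × V′) where

  Data : Setoid 0ℓ 0ℓ
  Data = ((V →-setoid V′) ×ₛ (V′ →-setoid V)) ×ₛ ((E →-setoid E′) ×ₛ (E′ →-setoid E))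

  Good : Setoid.Carrier Data → Set
  Good ((f , f⁻) , (h , h⁻)) =
    ((∀ y → f (f⁻ y) ≡ y) × (∀ x → f⁻ (f x) ≡ x)) ×
    ((∀ y → h (h⁻ y) ≡ y) × (∀ x → h⁻ (h x) ≡ x)) ×
    (∀ e → (f (proj₁ (ends e)) , f (proj₂ (ends e))) ≈ᵤ ends′ (h e))

  good-resp : Good Respects Setoid._≈_ Data
  good-resp {(f , f⁻) , (h , h⁻)} {(g , g⁻) , (k , k⁻)} ((p , p⁻) , (q , q⁻)) ((i , j) , (i′ , j′) , pr) =
      ((λ y → trans (sym (trans (p (f⁻ y)) (cong g (p⁻ y)))) (i y))
      , λ x → trans (sym (trans (p⁻ (f x)) (cong g⁻ (p x)))) (j x))
    , ((λ y → trans (sym (trans (q (h⁻ y)) (cong k (q⁻ y)))) (i′ y))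
      , λ x → trans (sym (trans (q⁻ (h x)) (cong k⁻ (q x)))) (j′ x))
    , λ e → U.trans (inj₁ (sym (p _) , sym (p _)))
              (U.trans (pr e) (U.reflexive (cong ends′ (q e))))
    where module U = Setoid (Unordered (setoid V′))

  good? : Decidable Good
  good? ((f , f⁻) , (h , h⁻)) =
    (∀?≡ finV′ (λ y → ≡? finV′ _ _) ×-dec ∀?≡ finV (λ x → ≡? finV _ _)) ×-dec
    (∀?≡ finE′ (λ y → ≡? finE′ _ _) ×-dec ∀?≡ finE (λ x → ≡? finE _ _)) ×-dec
    ∀?≡ finE (λ e → ≈ᵤ? finV′ _ _)

  iso? : Dec (discrete V E ends ≅ discrete V′ E′ ends′)
  iso? = map′ to from
    (∃? (×-finite (×-finite (→-finite finV finV′) (→-finite finV′ finV))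
                  (×-finite (→-finite finE finE′) (→-finite finE′ finE)))
        (λ {x} {y} → good-resp {x} {y}) good?)
    where
    to : ∃ Good → discrete V E ends ≅ discrete V′ E′ ends′
    to (((f , f⁻) , (h , h⁻)) , (i , j) , (i′ , j′) , pr) = record
      { vertices = record
        { to = f ; from = f⁻ ; to-cong = cong f ; from-cong = cong f⁻
        ; inverse = (λ { refl → i _ }) , (λ { refl → j _ }) }
      ; edges = record
        { to = h ; from = h⁻ ; to-cong = cong h ; from-cong = cong h⁻
        ; inverse = (λ { refl → i′ _ }) , (λ { refl → j′ _ }) }
      ; preserves-ends = pr
      }
    from : discrete V E ends ≅ discrete V′ E′ ends′ → ∃ Good
    from φ = ((v.to , v.from) , (e.to , e.from))
           , (v.strictlyInverseˡ , v.strictlyInverseʳ)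
           , (e.strictlyInverseˡ , e.strictlyInverseʳ)
           , _≅_.preserves-ends φ
      where module v = Inverse (_≅_.vertices φ)
            module e = Inverse (_≅_.edges φ)

-- Being a Cayley graph is decidable for finite multigraphs: it amounts to
-- the existence of a group structure on the vertices whose left
-- translations preserve adjacency, in a graph without loops or multiple
-- edges.
module CayleyDecision
  {V E : Set} (finV : FiniteSet V) (finE : FiniteSet E) (ends : E → V × V) where

  M : Multigraph
  M = discrete V E ends

  module U = Setoid (Unordered (setoid V))

  Joined : V → V → Set
  Joined x y = ∃[ e ] ends e ≈ᵤ (x , y)

  Simple : Set
  Simple = (∀ e → ¬ proj₁ (ends e) ≡ proj₂ (ends e)) ×
           (∀ e e′ → ends e ≈ᵤ ends e′ → e ≡ e′)

  Data : Setoid 0ℓ 0ℓ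
  Data = ((V × V) →-setoid V) ×ₛ (setoid V ×ₛ (V →-setoid V))

  Good : Setoid.Carrier Data → Set
  Good (m , ε , inv) =
    (∀ x y z → m (m (x , y) , z) ≡ m (x , m (y , z))) ×
    ((∀ x → m (ε , x) ≡ x) × (∀ x → m (x , ε) ≡ x)) ×
    ((∀ x → m (inv x , x) ≡ ε) × (∀ x → m (x , inv x) ≡ ε)) ×
    (∀ e g → Joined (m (g , proj₁ (ends e))) (m (g , proj₂ (ends e))))

  good-resp : Good Respects Setoid._≈_ Data
  good-resp {m , ε , inv} {m′ , ε , inv′} (p , refl , q) (as , (il , ir) , (vl , vr) , tr) =
      (λ x y z → trans (sym (trans (p _) (cong (λ t → m′ (t , z)) (p _))))
                   (trans (as x y z) (trans (p _) (cong (λ t → m′ (x , t)) (p _)))))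
    , ((λ x → trans (sym (p _)) (il x)) , (λ x → trans (sym (p _)) (ir x)))
    , ((λ x → trans (sym (trans (p _) (cong (λ t → m′ (t , x)) (q x)))) (vl x))
      , (λ x → trans (sym (trans (p _) (cong (λ t → m′ (x , t)) (q x)))) (vr x)))
    , λ e g → let (e′ , r) = tr e g in e′ , U.trans r (inj₁ (p _ , p _))

  good? : Decidable Good
  good? (m , ε , inv) =
    ∀?≡ finV (λ x → ∀?≡ finV λ y → ∀?≡ finV λ z → ≡? finV _ _) ×-dec
    (∀?≡ finV (λ x → ≡? finV _ _) ×-dec ∀?≡ finV (λ x → ≡? finV _ _)) ×-dec
    (∀?≡ finV (λ x → ≡? finV _ _) ×-dec ∀?≡ finV (λ x → ≡? finV _ _)) ×-dec
    ∀?≡ finE (λ e → ∀?≡ finV λ g → ∃?≡ finE λ e′ → ≈ᵤ? finV _ _)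

  simple? : Dec Simple
  simple? = ∀?≡ finE (λ e → ¬? (≡? finV _ _)) ×-dec
            ∀?≡ finE (λ e → ∀?≡ finE λ e′ → ≈ᵤ? finV _ _ →-dec ≡? finE e e′)

  toCayley : Simple × ∃ Good → IsCayley M
  toCayley ((noLoop , noMult) , (m , ε , inv) , as , (il , ir) , (vl , vr) , tr) =
    G , C , record
      { vertices = record
        { to = λ x → x ; from = λ x → x ; to-cong = λ p → p ; from-cong = λ p → p
        ; inverse = (λ p → p) , (λ p → p) }
      ; edges = record
        { to = h ; from = h⁻
        ; to-cong = λ { refl → U.refl }
        ; from-cong = λ {x} {y} p →
            noMult _ _ (U.trans (h⁻-ends x) (U.trans p (U.sym (h⁻-ends y))))
        ; inverse = (λ {x} {y} p → U.trans (h-ends y) (invl p))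
                  , (λ {x} {y} p → noMult _ _ (U.trans (h⁻-ends y) (U.trans p (h-ends x))))
        }
      ; preserves-ends = λ e → U.sym (h-ends e)
      }
    where
    open ≡-Reasoning
    _∙_ : V → V → V
    x ∙ y = m (x , y)

    G : Group 0ℓ 0ℓ
    G = record
      { Carrier = V ; _≈_ = _≡_ ; _∙_ = _∙_ ; ε = ε ; _⁻¹ = inv
      ; isGroup = record
        { isMonoid = record
          { isSemigroup = record
            { isMagma = record { isEquivalence = isEquivalence ; ∙-cong = cong₂ _∙_ }
            ; assoc = as }
          ; identity = il , ir }
        ; inverse = vl , vr
        ; ⁻¹-cong = cong inv } }

    translate : ∀ g {x y} → Joined x y → Joined (g ∙ x) (g ∙ y)
    translate g {x} {y} (e , p) with tr e g
    ... | e′ , r = e′ , U.trans r (move p)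
      where
      move : ∀ {u v} → (u , v) ≈ᵤ (x , y) → (g ∙ u , g ∙ v) ≈ᵤ (g ∙ x , g ∙ y)
      move (inj₁ (refl , refl)) = U.refl
      move (inj₂ (refl , refl)) = inj₂ (refl , refl)

    flip : ∀ {x y} → Joined x y → Joined y x
    flip (e , p) = e , U.trans p (inj₂ (refl , refl))

    C : ConnectionSet G
    C = record
      { S         = Joined ε
      ; resp      = λ { refl j → j }
      ; symmetric = λ {s} j → subst (λ t → Joined t (inv s)) (vl s)
                      (subst (Joined (inv s ∙ s)) (ir (inv s)) (translate (inv s) (flip j)))
      ; ε∉S       = λ where
          (e , inj₁ (p , q)) → noLoop e (trans p (sym q))
          (e , inj₂ (p , q)) → noLoop e (trans p (sym q))
      }

    edge : V × ∃ (Joined ε) → V × V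
    edge (g , s , _) = g , g ∙ s

    cancel : ∀ u v → u ∙ (inv u ∙ v) ≡ v
    cancel u v = trans (sym (as u (inv u) v)) (trans (cong (_∙ v) (vr u)) (il v))

    h : E → V × ∃ (Joined ε)
    h e = let (u , v) = ends e in
      u , inv u ∙ v , subst (λ t → Joined t (inv u ∙ v)) (vl u) (translate (inv u) (e , U.refl))

    h-ends : ∀ e → edge (h e) ≈ᵤ ends e
    h-ends e = inj₁ (refl , cancel _ _)

    h⁻-joined : ∀ x → Joined (proj₁ x) (proj₁ x ∙ proj₁ (proj₂ x))
    h⁻-joined (g , s , j) = subst (λ t → Joined t (g ∙ s)) (ir g) (translate g j)

    h⁻ : V × ∃ (Joined ε) → E
    h⁻ x = proj₁ (h⁻-joined x)

    h⁻-ends : ∀ x → ends (h⁻ x) ≈ᵤ edge x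
    h⁻-ends x = proj₂ (h⁻-joined x)

    invl : ∀ {x y} → y ≡ h⁻ x → ends y ≈ᵤ edge x
    invl {x} refl = h⁻-ends x

  fromCayley : IsCayley M → Simple × ∃ Good
  fromCayley (G , C , iso) =
    (noLoop , noMult) , (m , v.from ε , λ x → v.from (v.to x ⁻¹)) ,
    (λ x y z → v.inverseʳ (begin
       v.to (m (x , y)) ∙ v.to z     ≈⟨ ∙-congʳ (v.strictlyInverseˡ _) ⟩
       (v.to x ∙ v.to y) ∙ v.to z    ≈⟨ assoc _ _ _ ⟩
       v.to x ∙ (v.to y ∙ v.to z)    ≈⟨ ∙-congˡ (v.strictlyInverseˡ _) ⟨
       v.to x ∙ v.to (m (y , z))     ≈⟨ v.strictlyInverseˡ _ ⟨
       v.to (m (x , m (y , z)))      ∎)) ,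
    ((λ x → v.inverseʳ (G.trans (∙-congʳ (v.strictlyInverseˡ _)) (identityˡ _)))
    , (λ x → v.inverseʳ (G.trans (∙-congˡ (v.strictlyInverseˡ _)) (identityʳ _)))) ,
    ((λ x → v.from-cong (G.trans (∙-congʳ (v.strictlyInverseˡ _)) (inverseˡ _)))
    , (λ x → v.from-cong (G.trans (∙-congˡ (v.strictlyInverseˡ _)) (inverseʳ _)))) ,
    tr
    where
    module G = Group G
    open G using (_≈_; _∙_; ε; _⁻¹; assoc; identityˡ; identityʳ; inverseˡ; inverseʳ; ∙-congˡ; ∙-congʳ)
    open ConnectionSet C
    module UG = Setoid (Unordered G.setoid)
    module v = Inverse (_≅_.vertices iso)
    module e = Inverse (_≅_.edges iso)
    open SetoidReasoning G.setoid

    m : V × V → V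
    m (x , y) = v.from (v.to x ∙ v.to y)

    edge : G.Carrier × ∃ S → G.Carrier × G.Carrier
    edge (g , s , _) = g , g ∙ s

    image : ∀ e → UG._≈_ (v.to (proj₁ (ends e)) , v.to (proj₂ (ends e))) (edge (e.to e))
    image = _≅_.preserves-ends iso

    push : ∀ {p q} → p ≈ᵤ q → UG._≈_ (v.to (proj₁ p) , v.to (proj₂ p)) (v.to (proj₁ q) , v.to (proj₂ q))
    push (inj₁ (r , s)) = inj₁ (v.to-cong r , v.to-cong s)
    push (inj₂ (r , s)) = inj₂ (v.to-cong r , v.to-cong s)

    s≉ε : ∀ {g s} → S s → ¬ g ≈ g ∙ s
    s≉ε {g} {s} s∈S p = ε∉S (resp s≈ε s∈S)
      where
      s≈ε : s ≈ ε
      s≈ε = begin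
        s                ≈⟨ identityˡ s ⟨
        ε ∙ s            ≈⟨ ∙-congʳ (inverseˡ g) ⟨
        (g ⁻¹ ∙ g) ∙ s   ≈⟨ assoc _ _ _ ⟩
        g ⁻¹ ∙ (g ∙ s)   ≈⟨ ∙-congˡ p ⟨
        g ⁻¹ ∙ g         ≈⟨ inverseˡ g ⟩
        ε                ∎

    noLoop : ∀ e → ¬ proj₁ (ends e) ≡ proj₂ (ends e)
    noLoop e p with e.to e | image e
    ... | g , s , s∈S | inj₁ (q , r) = s≉ε s∈S (G.trans (G.sym q) (G.trans (v.to-cong p) r))
    ... | g , s , s∈S | inj₂ (q , r) = s≉ε s∈S (G.trans (G.sym r) (G.trans (v.to-cong (sym p)) q))

    noMult : ∀ e e′ → ends e ≈ᵤ ends e′ → e ≡ e′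
    noMult e e′ p = trans (sym (e.strictlyInverseʳ e))
      (e.inverseʳ (UG.trans (UG.sym (image e)) (UG.trans (push p) (image e′))))

    pull : ∀ {x y p} → UG._≈_ (v.to x , v.to y) p → (x , y) ≈ᵤ (v.from (proj₁ p) , v.from (proj₂ p))
    pull (inj₁ (r , s)) = inj₁ (sym (v.inverseʳ (G.sym r)) , sym (v.inverseʳ (G.sym s)))
    pull (inj₂ (r , s)) = inj₂ (sym (v.inverseʳ (G.sym r)) , sym (v.inverseʳ (G.sym s)))

    tr : ∀ e g → Joined (m (g , proj₁ (ends e))) (m (g , proj₂ (ends e)))
    tr e g with e.to e | image e
    ... | x , s , s∈S | q = e₁ , U.trans (pull (UG.trans im₁ target)) U.refl
      where
      new : G.Carrier × ∃ S
      new = v.to g ∙ x , s , s∈S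
      e₁ : E
      e₁ = e.from new
      im₁ : UG._≈_ (v.to (proj₁ (ends e₁)) , v.to (proj₂ (ends e₁))) (edge new)
      im₁ = UG.trans (image e₁) (e.strictlyInverseˡ new)
      shift : ∀ {c d} → UG._≈_ (c , d) (x , x ∙ s) →
              UG._≈_ (edge new) (v.to g ∙ c , v.to g ∙ d)
      shift (inj₁ (r , t)) = inj₁ (∙-congˡ (G.sym r) , G.trans (assoc _ _ _) (∙-congˡ (G.sym t)))
      shift (inj₂ (r , t)) = inj₂ (∙-congˡ (G.sym t) , G.trans (assoc _ _ _) (∙-congˡ (G.sym r)))
      target : UG._≈_ (edge new) (v.to g ∙ v.to (proj₁ (ends e)) , v.to g ∙ v.to (proj₂ (ends e)))
      target = shift q

  cayley? : Dec (IsCayley M)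
  cayley? = map′ toCayley fromCayley
    (simple? ×-dec
     ∃? (×-finite (→-finite (×-finite≡ finV finV) finV) (×-finite finV (→-finite finV finV)))
        (λ {x} {y} → good-resp {x} {y}) good?)

Pair : Set
Pair = ℕ × ℕ

infix 4 _≃_ _≃?_

_≃_ : Pair → Pair → Set
(n , k) ≃ (n′ , k′) = P n k ≅ P n′ k′

_≃?_ : Decidable₂ _≃_
(n , k) ≃? (n′ , k′) =
  IsoDecision.iso? (⊎-finite Fin-finite Fin-finite) (⊎-finite Fin-finite (⊎-finite Fin-finite Fin-finite))
                   (⊎-finite Fin-finite Fin-finite) (⊎-finite Fin-finite (⊎-finite Fin-finite Fin-finite))
                   (petersenEnds n k) (petersenEnds n′ k′)

Cayley : Pair → Set₁
Cayley (n , k) = IsCayley (P n k)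

cayley? : Decidable Cayley
cayley? (n , k) =
  CayleyDecision.cayley? (⊎-finite Fin-finite Fin-finite)
                         (⊎-finite Fin-finite (⊎-finite Fin-finite Fin-finite))
                         (petersenEnds n k)

Admissible : Pair → Set
Admissible (n , k) = 3 ≤ n × 1 ≤ k × 2 * k ≤ n

admissible? : Decidable Admissible
admissible? (n , k) = 3 ≤? n ×-dec 1 ≤? k ×-dec 2 * k ≤? n

-- Since k ≤ n, letting both coordinates range over 0, …, N loses nothing.
pairsUpTo : ℕ → List Pair
pairsUpTo N = filter admissible? (cartesianProduct (upTo (suc N)) (upTo (suc N)))

#classes : List Pair → ℕ
#classes xs = length (deduplicate _≃?_ xs)

A : ℕ → ℕ
A N = #classes (pairsUpTo N)

B : ℕ → ℕ
B N = #classes (filter cayley? (pairsUpTo N))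

{-# OPTIONS --safe #-}

-- P(n,k) is a quotient of a fixed cubic graph over ℤ × ℤ, two copies of the
-- plane joined by spokes, with (α , β) read as α + β k mod n.  If no nonzero
-- (α , β) with |α| , |β| ≤ 8 satisfies α + β k ≡ 0, then two consecutive rim
-- edges lie on no closed non-backtracking walk of length 8, whereas a spoke
-- followed by any other edge always does.  Hence an isomorphism from P(n,k) to
-- P(n,k′) maps the rim to the rim or to an inner cycle, which forces k ≡ ±k′ or
-- k k′ ≡ ±1; for a Cayley graph, an automorphism moving a₀ to b₀ gives k² ≡ ±1.
-- Two solutions of one relation α + β k ≡ 0 or k² ≡ ±1 (with k fixed mod 3)
-- modulo a large n cannot lie in one window of length D, so B(N) = O(N²/D) for
-- each fixed D.  Pairs of even n and even k with 8 k + 8 < n are pairwise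
-- non-isomorphic, so A(N) is at least a constant times N².
module Submission where

open import Defs
open import Data.Nat.Base using (ℕ; NonZero; _≤_)
open import Data.Integer.Base using (+_)
open import Data.Rational.Base using (ℚ; 0ℚ; _/_; _-_; ∣_∣; _<_)
open import Data.Product.Base using (∃-syntax; Σ-syntax)

open import Data.Empty using (⊥-elim)
open import Data.Fin.Base
  using (Fin; zero; suc; toℕ; fromℕ<; join; splitAt; remQuot; combine)
open import Data.Fin.Properties
  using (toℕ-fromℕ<; toℕ<n; toℕ-injective; toℕ≤pred[n]; any?; injective⇒≤;
         splitAt-join; join-splitAt; combine-remQuot)
open import Data.Integer.Base as ℤ using (ℤ; -[1+_]; 0ℤ; 1ℤ)
open import Data.Integer.DivMod using (_%ℕ_; _/ℕ_; n%ℕd<d; a≡a%ℕn+[a/ℕn]*n)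
open import Data.Integer.Divisibility.Signed
  using (_∣_; _∣?_; divides; ∣⇒∣ᵤ; ∣ᵤ⇒∣; ∣-trans;
         ∣m∣n⇒∣m+n; ∣m∣n⇒∣m-n; ∣n⇒∣m*n; ∣m⇒∣-m)
import Data.Integer.Properties as ℤ
open import Data.Integer.Tactic.RingSolver using (solve-∀)
open import Data.List.Base
  using (List; []; _∷_; length; lookup; filter; deduplicate; upTo; cartesianProduct)
open import Data.List.Membership.Propositional using (_∈_)
open import Data.List.Membership.Propositional.Properties
  using (∈-lookup; ∈-filter⁺; ∈-filter⁻; ∈-cartesianProduct⁺; ∈-cartesianProduct⁻;
         ∈-upTo⁺; ∈-upTo⁻)
open import Data.List.Properties using (length-deduplicate)
import Data.List.Relation.Unary.All as All
open import Data.List.Relation.Unary.AllPairs using (_∷_)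
open import Data.List.Relation.Unary.Any as Any using (Any)
import Data.List.Relation.Unary.Any.Properties as Any
open import Data.List.Relation.Unary.Unique.Propositional using (Unique)
import Data.List.Relation.Unary.Unique.Propositional.Properties as Unique
open import Data.Nat.Base as ℕ using (zero; suc; s≤s; z≤n)
open import Data.Nat.DivMod as ℕ
  using (_mod_; _%_; m≡m%n+[m/n]*n; m%n<n; m/n*n≤m; m*n/n≡m; /-monoˡ-≤)
import Data.Nat.Divisibility as ℕ
import Data.Nat.Properties as ℕ
import Data.Nat.Tactic.RingSolver as ℕ-Solver
open import Data.Product.Base using (_×_; _,_; proj₁; proj₂)
open import Data.Rational.Base as ℚ using (mkℚ; *<*)
import Data.Rational.Properties as ℚ
import Data.Rational.Unnormalised.Base as ℚᵘ
import Data.Rational.Unnormalised.Properties as ℚᵘ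
open import Data.Sum.Base using (_⊎_; inj₁; inj₂)
open import Data.Sum.Properties using (inj₁-injective; inj₂-injective)
open import Data.Unit.Base using (⊤; tt)
open import Function.Bundles using (Inverse)
open import Relation.Binary.PropositionalEquality
  using (_≡_; _≢_; refl; sym; trans; cong; cong₂; subst; subst₂)
open import Relation.Nullary
  using (¬_; Dec; yes; no; contradiction; map′; ¬?; _×-dec_; _→-dec_; from-yes; from-no)

-- Positions modulo n

∣-resp : ∀ {i x y} → x ≡ y → i ∣ x → i ∣ y
∣-resp {i} = subst (i ∣_)

multiple-below⇒0 : ∀ {n z} → + n ∣ z → ℤ.∣ z ∣ ℕ.< n → z ≡ 0ℤ
multiple-below⇒0 {n} {z} n∣z z<n with ℤ.∣ z ∣ in eq
... | zero  = ℤ.∣i∣≡0⇒i≡0 eq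
... | suc m = contradiction (subst (n ℕ.∣_) eq (∣⇒∣ᵤ n∣z)) (ℕ.>⇒∤ z<n)

∣+m-+n∣<o : ∀ {m n o} → m ℕ.< o → n ℕ.< o → ℤ.∣ + m ℤ.- + n ∣ ℕ.< o
∣+m-+n∣<o {m} {n} {o} m<o n<o = subst (λ z → ℤ.∣ z ∣ ℕ.< o) (sym (ℤ.m-n≡m⊖n m n))
  (ℕ.≤-<-trans (ℤ.∣m⊝n∣≤m⊔n m n) (ℕ.⊔-lub m<o n<o))

data Side : Set where
  outside inside : Side

other : Side → Side
other outside = inside
other inside  = outside

Vertex : ℕ → Set
Vertex n = Fin n ⊎ Fin n

at : ∀ {n} → Side → Fin n → Vertex n
at outside i = a i
at inside  i = b i

-- Multiplicity is forgotten here: the arguments about walks depend only on whether some edge joins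
-- two vertices.
record Adjacent (n k : ℕ) (x y : Vertex n) : Set where
  constructor _joins_
  field
    edge : Fin n ⊎ Fin n ⊎ Fin n
    ends : petersenEnds n k edge ≈ᵤ (x , y)

Adjacent-sym : ∀ {n k x y} → Adjacent n k x y → Adjacent n k y x
Adjacent-sym (e joins inj₁ p) = e joins inj₂ p
Adjacent-sym (e joins inj₂ p) = e joins inj₁ p

jump : ℕ → Side → ℤ
jump k outside = 1ℤ
jump k inside  = + k

data _∈±_ (v u : ℤ) : Set where
  plus  : v ≡ u → v ∈± u
  minus : v ≡ ℤ.- u → v ∈± u

module Residues (n : ℕ) {{_ : NonZero n}} where

  infix 4 _≋_

  -- A record rather than a bare divisibility, so that `x` and `y` can be inferred from the type;
  -- unification cannot recover them from the difference.
  record _≋_ (x y : ℤ) : Set where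
    constructor mod
    field divides-difference : + n ∣ x ℤ.- y

  open _≋_ public

  ≋-resp : ∀ {x y u v} → x ℤ.- y ≡ u ℤ.- v → x ≋ y → u ≋ v
  ≋-resp eq (mod p) = mod (∣-resp eq p)

  ≋-refl : ∀ {x} → x ≋ x
  ≋-refl {x} = mod (∣-resp (sym (ℤ.+-inverseʳ x)) (divides 0ℤ refl))

  ≋-sym : ∀ {x y} → x ≋ y → y ≋ x
  ≋-sym {x} {y} (mod p) = mod (∣-resp (lem x y) (∣m⇒∣-m p))
    where
    lem : ∀ x y → ℤ.- (x ℤ.- y) ≡ y ℤ.- x
    lem = solve-∀

  ≋-trans : ∀ {x y z} → x ≋ y → y ≋ z → x ≋ z
  ≋-trans {x} {y} {z} (mod p) (mod q) = mod (∣-resp (lem x y z) (∣m∣n⇒∣m+n p q))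
    where
    lem : ∀ x y z → (x ℤ.- y) ℤ.+ (y ℤ.- z) ≡ x ℤ.- z
    lem = solve-∀

  +-congʳ : ∀ {x y} z → x ≋ y → x ℤ.+ z ≋ y ℤ.+ z
  +-congʳ {x} {y} z = ≋-resp (lem x y z)
    where
    lem : ∀ x y z → x ℤ.- y ≡ x ℤ.+ z ℤ.- (y ℤ.+ z)
    lem = solve-∀

  abstract
    -- Opaque, so that division by `n` is never unfolded; `residue-≋` says all that is needed about
    -- it.
    residue : ℤ → Fin n
    residue z = fromℕ< (n%ℕd<d z n)

    residue-≋ : ∀ z → z ≋ + toℕ (residue z)
    residue-≋ z = mod (divides (z /ℕ n) (trans
      (cong (λ r → z ℤ.- + r) (toℕ-fromℕ< (n%ℕd<d z n)))
      (trans (cong (ℤ._- + (z %ℕ n)) (a≡a%ℕn+[a/ℕn]*n z n)) (lem (+ (z %ℕ n)) _))))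
      where
      lem : ∀ r m → r ℤ.+ m ℤ.- r ≡ m
      lem = solve-∀

  toℕ-≋-injective : ∀ {i j : Fin n} → + toℕ i ≋ + toℕ j → i ≡ j
  toℕ-≋-injective {i} {j} p = toℕ-injective (ℤ.+-injective (ℤ.i-j≡0⇒i≡j _ _
    (multiple-below⇒0 (divides-difference p) (∣+m-+n∣<o (toℕ<n i) (toℕ<n j)))))

  residue-unique : ∀ {z i} → z ≋ + toℕ i → residue z ≡ i
  residue-unique p = toℕ-≋-injective (≋-trans (≋-sym (residue-≋ _)) p)

  residue-⊕ : ∀ i k → i ⊕ k ≡ residue (+ toℕ i ℤ.+ + k)
  residue-⊕ i k = sym (residue-unique (mod (divides (+ (m ℕ./ n)) (trans
    (cong₂ (λ u v → + u ℤ.- + v) (ℕ.m≡m%n+[m/n]*n m n) toℕ-⊕)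
    (lem (+ (m ℕ.% n)) _ _ (ℤ.pos-* (m ℕ./ n) n))))))
    where
    m = toℕ i ℕ.+ k
    toℕ-⊕ : toℕ (i ⊕ k) ≡ m ℕ.% n
    toℕ-⊕ = toℕ-fromℕ< _
    lem : ∀ r q q′ → q ≡ q′ → r ℤ.+ q ℤ.- r ≡ q′
    lem r q q′ refl = lem′ r q
      where
      lem′ : ∀ r q → r ℤ.+ q ℤ.- r ≡ q
      lem′ = solve-∀

  -- Vertices are indexed by integers, so that walking along a cycle is addition in ℤ; indices
  -- matter only modulo `n`.
  pos : Side → ℤ → Vertex n
  pos s z = at s (residue z)

  pos-cong : ∀ s {y z} → y ≋ z → pos s y ≡ pos s z
  pos-cong s p = cong (at s) (residue-unique (≋-trans p (residue-≋ _)))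

  pos-injective : ∀ s {y z} → pos s y ≡ pos s z → y ≋ z
  pos-injective s {y} {z} p = ≋-trans (residue-≋ y)
    (subst (λ i → + toℕ i ≋ z) (sym (at-injective s p)) (≋-sym (residue-≋ z)))
    where
    at-injective : ∀ s {i j : Fin n} → at s i ≡ at s j → i ≡ j
    at-injective outside refl = refl
    at-injective inside  refl = refl

  pos-disjoint : ∀ s {y z} → pos s y ≢ pos (other s) z
  pos-disjoint outside ()
  pos-disjoint inside  ()

  pos-sides : ∀ s s′ {y z} → pos s y ≡ pos s′ z → s ≡ s′
  pos-sides outside outside _ = refl
  pos-sides inside  inside  _ = refl

  residue-toℕ : ∀ i → residue (+ toℕ i) ≡ i
  residue-toℕ i = residue-unique ≋-refl

  pos-surjective : ∀ x → ∃[ s ] ∃[ z ] x ≡ pos s z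
  pos-surjective (a i) = outside , + toℕ i , cong a (sym (residue-toℕ i))
  pos-surjective (b i) = inside  , + toℕ i , cong b (sym (residue-toℕ i))

  module _ (k : ℕ) where

    residue-shift : ∀ z j → residue z ⊕ j ≡ residue (z ℤ.+ + j)
    residue-shift z j = trans (residue-⊕ (residue z) j)
      (residue-unique (≋-trans (+-congʳ (+ j) (≋-sym (residue-≋ z))) (residue-≋ (z ℤ.+ + j))))

    adjacent-jump : ∀ s z → Adjacent n k (pos s z) (pos s (z ℤ.+ jump k s))
    adjacent-jump outside z = rim (residue z) joins inj₁ (refl , cong a (residue-shift z 1))
    adjacent-jump inside  z = inner (residue z) joins inj₁ (refl , cong b (residue-shift z k))

    adjacent-spoke : ∀ s z → Adjacent n k (pos s z) (pos (other s) z)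
    adjacent-spoke outside z = spoke (residue z) joins inj₁ (refl , refl)
    adjacent-spoke inside  z = spoke (residue z) joins inj₂ (refl , refl)

    adjacent-± : ∀ s z {v} → v ∈± jump k s → Adjacent n k (pos s z) (pos s (z ℤ.+ v))
    adjacent-± s z (plus refl)  = adjacent-jump s z
    adjacent-± s z (minus refl) = Adjacent-sym
      (subst (Adjacent n k _) (cong (pos s) (lem z (jump k s))) (adjacent-jump s (z ℤ.+ ℤ.- jump k s)))
      where
      lem : ∀ z u → z ℤ.+ ℤ.- u ℤ.+ u ≡ z
      lem = solve-∀

    edge-ends : ∀ e → (∃[ s ] ∃[ z ] petersenEnds n k e ≡ (pos s z , pos s (z ℤ.+ jump k s)))
                    ⊎ (∃[ z ] petersenEnds n k e ≡ (pos outside z , pos inside z))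
    edge-ends (rim i)   = inj₁ (outside , + toℕ i , cong₂ _,_ (cong a (sym (residue-toℕ i))) (cong a (residue-⊕ i 1)))
    edge-ends (spoke i) = inj₂ (+ toℕ i , cong₂ _,_ (cong a (sym (residue-toℕ i))) (cong b (sym (residue-toℕ i))))
    edge-ends (inner i) = inj₁ (inside , + toℕ i , cong₂ _,_ (cong b (sym (residue-toℕ i))) (cong b (residue-⊕ i k)))

    neighbour : ∀ s z {y} → Adjacent n k (pos s z) y →
                (∃[ v ] v ∈± jump k s × y ≡ pos s (z ℤ.+ v)) ⊎ y ≡ pos (other s) z
    neighbour s z (e joins p) with petersenEnds n k e | edge-ends e
    neighbour s z (e joins inj₁ (p , refl)) | _ | inj₁ (s′ , w , refl) with pos-sides s′ s p
    ... | refl = inj₁ (jump k s , plus refl , pos-cong s (+-congʳ (jump k s) (pos-injective s p)))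
    neighbour s z (e joins inj₂ (refl , p)) | _ | inj₁ (s′ , w , refl) with pos-sides s′ s p
    ... | refl = inj₁ (ℤ.- jump k s , minus refl ,
                       pos-cong s (≋-resp (lem w z (jump k s)) (pos-injective s p)))
      where
      lem : ∀ w z u → w ℤ.+ u ℤ.- z ≡ w ℤ.- (z ℤ.+ ℤ.- u)
      lem = solve-∀
    neighbour outside z (e joins inj₁ (p , refl)) | _ | inj₂ (w , refl) = inj₂ (pos-cong inside (pos-injective outside p))
    neighbour outside z (e joins inj₂ (refl , ())) | _ | inj₂ (w , refl)
    neighbour inside z (e joins inj₁ (() , refl)) | _ | inj₂ (w , refl)
    neighbour inside z (e joins inj₂ (refl , p)) | _ | inj₂ (w , refl) = inj₂ (pos-cong outside (pos-injective inside p))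

-- Octagons in the ℤ × ℤ cover

-- In `Walk _~_ x y m t` the walk stands at `y`, has just come from `x`, and reaches `t` after `m`
-- further steps. Remembering `x` is what forbids backtracking.
data Walk {V : Set} (_~_ : V → V → Set) : V → V → ℕ → V → Set where
  stop : ∀ {x y} → Walk _~_ x y 0 y
  go   : ∀ {x y z m t} → y ~ z → x ≢ z → Walk _~_ y z m t → Walk _~_ x y (suc m) t

Walk-map : ∀ {V V′ : Set} {_~_ : V → V → Set} {_~′_ : V′ → V′ → Set} (f : V → V′) →
           (∀ {x y} → f x ≡ f y → x ≡ y) → (∀ {x y} → x ~ y → f x ~′ f y) →
           ∀ {x y m t} → Walk _~_ x y m t → Walk _~′_ (f x) (f y) m (f t)
Walk-map f inj adj stop         = stop
Walk-map f inj adj (go p x≢z w) = go (adj p) (λ eq → x≢z (inj eq)) (Walk-map f inj adj w)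

data Direction : Set where
  forth back across : Direction

opposite : Direction → Direction
opposite forth  = back
opposite back   = forth
opposite across = across

CoverVertex : Set
CoverVertex = Side × ℤ × ℤ

origin : Side → CoverVertex
origin s = s , 0ℤ , 0ℤ

move : Direction → CoverVertex → CoverVertex
move forth  (outside , α , β) = outside , α ℤ.+ 1ℤ , β
move forth  (inside  , α , β) = inside  , α , β ℤ.+ 1ℤ
move back   (outside , α , β) = outside , α ℤ.- 1ℤ , β
move back   (inside  , α , β) = inside  , α , β ℤ.- 1ℤ
move across (s , α , β)       = other s , α , β

i+1-1≡i : ∀ i → i ℤ.+ 1ℤ ℤ.- 1ℤ ≡ i
i+1-1≡i = solve-∀

i-1+1≡i : ∀ i → i ℤ.- 1ℤ ℤ.+ 1ℤ ≡ i
i-1+1≡i = solve-∀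

move-opposite : ∀ d c → move (opposite d) (move d c) ≡ c
move-opposite forth  (outside , α , β) = cong (λ i → outside , i , β) (i+1-1≡i α)
move-opposite forth  (inside  , α , β) = cong (λ i → inside , α , i) (i+1-1≡i β)
move-opposite back   (outside , α , β) = cong (λ i → outside , i , β) (i-1+1≡i α)
move-opposite back   (inside  , α , β) = cong (λ i → inside , α , i) (i-1+1≡i β)
move-opposite across (outside , α , β) = refl
move-opposite across (inside  , α , β) = refl

_≟ᵈ_ : (d e : Direction) → Dec (d ≡ e)
forth  ≟ᵈ forth  = yes refl
forth  ≟ᵈ back   = no λ ()
forth  ≟ᵈ across = no λ ()
back   ≟ᵈ forth  = no λ ()
back   ≟ᵈ back   = yes refl
back   ≟ᵈ across = no λ ()
across ≟ᵈ forth  = no λ ()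
across ≟ᵈ back   = no λ ()
across ≟ᵈ across = yes refl

∀ᵈ? : ∀ {Q : Direction → Set} → (∀ d → Dec (Q d)) → Dec (∀ d → Q d)
∀ᵈ? Q? = map′ (λ { (f , g , h) → λ { forth → f ; back → g ; across → h } })
              (λ q → q forth , q back , q across)
              (Q? forth ×-dec Q? back ×-dec Q? across)

-- `d` is the move that led to `c`; of the `m` remaining moves none may undo the one before it.
AllEnds : (CoverVertex → Set) → Direction → ℕ → CoverVertex → Set
AllEnds Q d zero    c = Q c
AllEnds Q d (suc m) c = ∀ d′ → d′ ≢ opposite d → AllEnds Q d′ m (move d′ c)

allEnds? : ∀ {Q} → (∀ c → Dec (Q c)) → ∀ d m c → Dec (AllEnds Q d m c)
allEnds? Q? d zero    c = Q? c
allEnds? Q? d (suc m) c = ∀ᵈ? λ d′ → ¬? (d′ ≟ᵈ opposite d) →-dec allEnds? Q? d′ m (move d′ c)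

-- Inside points carry no condition, because a walk that ends there cannot have closed up at an
-- outside vertex. The bounds by 8 make `Generic` applicable.
OffOrigin : CoverVertex → Set
OffOrigin (outside , α , β) = ℤ.∣ α ∣ ℕ.≤ 8 × ℤ.∣ β ∣ ℕ.≤ 8 × ¬ (α ≡ 0ℤ × β ≡ 0ℤ)
OffOrigin (inside  , α , β) = ⊤

offOrigin? : ∀ c → Dec (OffOrigin c)
offOrigin? (outside , α , β) =
  ℤ.∣ α ∣ ℕ.≤? 8 ×-dec ℤ.∣ β ∣ ℕ.≤? 8 ×-dec ¬? (α ℤ.≟ 0ℤ ×-dec β ℤ.≟ 0ℤ)
offOrigin? (inside  , α , β) = yes tt

abstract
  -- Settled by evaluation: two `forth` moves from the origin have 2⁶ = 64 non-backtracking
  -- continuations of length six.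
  straight-not-closing : AllEnds OffOrigin forth 6 (outside , + 2 , 0ℤ)
  straight-not-closing = from-yes (allEnds? offOrigin? forth 6 (outside , + 2 , 0ℤ))

Generic : ℕ → ℕ → Set
Generic n k = ∀ α β → ℤ.∣ α ∣ ℕ.≤ 8 → ℤ.∣ β ∣ ℕ.≤ 8 → + n ∣ α ℤ.+ β ℤ.* + k → α ≡ 0ℤ × β ≡ 0ℤ

-- These are the non-backtracking pairs of moves that contain a spoke; the only other
-- non-backtracking pairs are `forth` twice and `back` twice.
data Turn : Direction → Direction → Set where
  from-forth : Turn forth across
  from-back  : Turn back across
  to-forth   : Turn across forth
  to-back    : Turn across back

data Turning : Direction → List Direction → Set where
  []  : ∀ {d} → Turning d []
  _∷_ : ∀ {d d′ ds} → Turn d d′ → Turning d′ ds → Turning d (d′ ∷ ds)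

-- Together with the two moves of the turn, each of these lists makes eight moves alternating
-- between spokes and jumps. The four jumps change α and β alternately and cancel in pairs, so the
-- walk closes.
around-from-forth : Turning across (forth ∷ across ∷ back ∷ across ∷ back ∷ across ∷ [])
around-from-forth = to-forth ∷ from-forth ∷ to-back ∷ from-back ∷ to-back ∷ from-back ∷ []

around-from-back : Turning across (forth ∷ across ∷ forth ∷ across ∷ back ∷ across ∷ [])
around-from-back = to-forth ∷ from-forth ∷ to-forth ∷ from-forth ∷ to-back ∷ from-back ∷ []

around-to-forth : Turning forth (across ∷ forth ∷ across ∷ back ∷ across ∷ back ∷ [])
around-to-forth = from-forth ∷ to-forth ∷ from-forth ∷ to-back ∷ from-back ∷ to-back ∷ []

around-to-back : Turning back (across ∷ forth ∷ across ∷ forth ∷ across ∷ back ∷ [])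
around-to-back = from-back ∷ to-forth ∷ from-forth ∷ to-forth ∷ from-forth ∷ to-back ∷ []

follow : List Direction → CoverVertex → CoverVertex
follow []       c = c
follow (d ∷ ds) c = follow ds (move d c)

module _ (n : ℕ) {{_ : NonZero n}} (k : ℕ) (z₀ : ℤ) where
  open Residues n

  place : ℤ → ℤ → ℤ
  place α β = z₀ ℤ.+ (α ℤ.+ β ℤ.* + k)

  π : CoverVertex → Vertex n
  π (s , α , β) = pos s (place α β)

  place-α : ∀ α β v → place α β ℤ.+ v ≡ place (α ℤ.+ v) β
  place-α α β v = lem z₀ α β v (+ k)
    where
    lem : ∀ z α β v k → z ℤ.+ (α ℤ.+ β ℤ.* k) ℤ.+ v ≡ z ℤ.+ (α ℤ.+ v ℤ.+ β ℤ.* k)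
    lem = solve-∀

  place-β⁺ : ∀ α β → place α β ℤ.+ + k ≡ place α (β ℤ.+ 1ℤ)
  place-β⁺ α β = lem z₀ α β (+ k)
    where
    lem : ∀ z α β k → z ℤ.+ (α ℤ.+ β ℤ.* k) ℤ.+ k ≡ z ℤ.+ (α ℤ.+ (β ℤ.+ 1ℤ) ℤ.* k)
    lem = solve-∀

  place-β⁻ : ∀ α β → place α β ℤ.- + k ≡ place α (β ℤ.- 1ℤ)
  place-β⁻ α β = lem z₀ α β (+ k)
    where
    lem : ∀ z α β k → z ℤ.+ (α ℤ.+ β ℤ.* k) ℤ.- k ≡ z ℤ.+ (α ℤ.+ (β ℤ.- 1ℤ) ℤ.* k)
    lem = solve-∀

  π-forth : ∀ s α β → pos s (place α β ℤ.+ jump k s) ≡ π (move forth (s , α , β))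
  π-forth outside α β = cong (pos outside) (place-α α β 1ℤ)
  π-forth inside  α β = cong (pos inside) (place-β⁺ α β)

  π-back : ∀ s α β → pos s (place α β ℤ.- jump k s) ≡ π (move back (s , α , β))
  π-back outside α β = cong (pos outside) (place-α α β (ℤ.- 1ℤ))
  π-back inside  α β = cong (pos inside) (place-β⁻ α β)

  adjacent-move : ∀ d c → Adjacent n k (π c) (π (move d c))
  adjacent-move forth  c@(s , α , β) = subst (Adjacent n k (π c)) (π-forth s α β) (adjacent-± k s _ (plus refl))
  adjacent-move back   c@(s , α , β) = subst (Adjacent n k (π c)) (π-back s α β) (adjacent-± k s _ (minus refl))
  adjacent-move across (s , α , β)   = adjacent-spoke k s _

  neighbour-move : ∀ c {y} → Adjacent n k (π c) y → ∃[ d ] y ≡ π (move d c)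
  neighbour-move (s , α , β) p with neighbour k s _ p
  ... | inj₁ (_ , plus refl  , eq) = forth , trans eq (π-forth s α β)
  ... | inj₁ (_ , minus refl , eq) = back , trans eq (π-back s α β)
  ... | inj₂ eq                    = across , eq

  -- A walk lifts to the cover one move at a time. A lifted move that undid its predecessor would
  -- return to the previous vertex, which `go` excludes, so the lift is among those that `AllEnds`
  -- ranges over.
  walk-end : ∀ Q d m c {t} → AllEnds Q d m c →
             Walk (Adjacent n k) (π (move (opposite d) c)) (π c) m t → ∃[ c′ ] Q c′ × t ≡ π c′
  walk-end Q d zero    c q stop = c , q , refl
  walk-end Q d (suc m) c q (go p x≢z w) with neighbour-move c p
  ... | d′ , refl = walk-end Q d′ m (move d′ c) (q d′ λ { refl → x≢z refl })
        (subst (λ c′ → Walk (Adjacent n k) (π c′) (π (move d′ c)) m _) (sym (move-opposite d′ c)) w)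

  -- The lifted walk ends at a point (α , β) over the starting vertex, so α + β k ≡ 0 and genericity
  -- gives α = β = 0; the check on the cover rules this out.
  straight-rim : Generic n k →
                 ¬ Walk (Adjacent n k) (π (outside , + 1 , 0ℤ)) (π (outside , + 2 , 0ℤ)) 6 (π (origin outside))
  straight-rim gen w with walk-end OffOrigin forth 6 (outside , + 2 , 0ℤ) straight-not-closing w
  ... | (outside , α , β) , (α≤8 , β≤8 , nz) , eq =
        nz (gen α β α≤8 β≤8 (∣-resp (lem z₀ α β (+ k)) (divides-difference (pos-injective outside (sym eq)))))
    where
    lem : ∀ z α β k → z ℤ.+ (α ℤ.+ β ℤ.* k) ℤ.- (z ℤ.+ (0ℤ ℤ.+ 0ℤ ℤ.* k)) ≡ α ℤ.+ β ℤ.* k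
    lem = solve-∀
  ... | (inside , _) , _ , ()

  -- A turn changes side exactly once.
  turn-distinct : ∀ {d d′} c → Turn d d′ → π c ≢ π (move d′ (move d c))
  turn-distinct (outside , _) from-forth ()
  turn-distinct (outside , _) from-back  ()
  turn-distinct (outside , _) to-forth   ()
  turn-distinct (outside , _) to-back    ()
  turn-distinct (inside  , _) from-forth ()
  turn-distinct (inside  , _) from-back  ()
  turn-distinct (inside  , _) to-forth   ()
  turn-distinct (inside  , _) to-back    ()

  turning-walk : ∀ c d {ds} → Turning d ds →
                 Walk (Adjacent n k) (π c) (π (move d c)) (length ds) (π (follow ds (move d c)))
  turning-walk c d []       = stop
  turning-walk c d {d′ ∷ _} (t ∷ ts) = go (adjacent-move d′ (move d c)) (turn-distinct c t) (turning-walk (move d c) d′ ts)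

  -- The face of the cover spanned by a rim edge and an inner edge.
  octagon : ∀ s {d d′} → Turn d d′ →
            let c₁ = move d (origin s) in
            Walk (Adjacent n k) (π c₁) (π (move d′ c₁)) 6 (π (origin s))
  octagon outside from-forth = turning-walk (move forth (origin outside)) across around-from-forth
  octagon outside from-back  = turning-walk (move back (origin outside)) across around-from-back
  octagon outside to-forth   = turning-walk (move across (origin outside)) forth around-to-forth
  octagon outside to-back    = turning-walk (move across (origin outside)) back around-to-back
  octagon inside  from-forth = turning-walk (move forth (origin inside)) across around-from-forth
  octagon inside  from-back  = turning-walk (move back (origin inside)) across around-from-back
  octagon inside  to-forth   = turning-walk (move across (origin inside)) forth around-to-forth
  octagon inside  to-back    = turning-walk (move across (origin inside)) back around-to-back

-- The image of the rim under an isomorphism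

-- Isomorphisms of multigraphs and left translations by a group element both yield such a bijection
-- of vertices, so one analysis serves both.
record Similarity (p q : Pair) : Set where
  private
    _~_  = Adjacent (proj₁ p) (proj₂ p)
    _~′_ = Adjacent (proj₁ q) (proj₂ q)
  field
    to            : Vertex (proj₁ p) → Vertex (proj₁ q)
    from          : Vertex (proj₁ q) → Vertex (proj₁ p)
    to-from       : ∀ y → to (from y) ≡ y
    from-to       : ∀ x → from (to x) ≡ x
    to-adjacent   : ∀ {x y} → x ~ y → to x ~′ to y
    from-adjacent : ∀ {x y} → x ~′ y → from x ~ from y

  to-injective : ∀ {x y} → to x ≡ to y → x ≡ y
  to-injective {x} {y} eq = trans (sym (from-to x)) (trans (cong from eq) (from-to y))

  from-injective : ∀ {x y} → from x ≡ from y → x ≡ y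
  from-injective {x} {y} eq = trans (sym (to-from x)) (trans (cong to eq) (to-from y))

neg-∈± : ∀ {v u} → v ∈± u → (ℤ.- v) ∈± u
neg-∈± {_} {u} (plus refl)  = minus refl
neg-∈± {_} {u} (minus refl) = plus (ℤ.neg-involutive u)

∈±-compare : ∀ {v v′ u} → v ∈± u → v′ ∈± u → v′ ∈± v
∈±-compare (plus refl)  q            = q
∈±-compare {_} {_} {u} (minus refl) (plus refl)  = minus (sym (ℤ.neg-involutive u))
∈±-compare (minus refl) (minus refl) = plus refl

module _ (n : ℕ) {{_ : NonZero n}} {k k′ : ℕ} (generic : Generic n k) (φ : Similarity (n , k) (n , k′)) where
  open Residues n
  open Similarity φ

  extrapolate : ∀ {p₁ q₁ p₀ q₀} → p₁ ≋ q₁ → p₀ ≋ q₀ → p₁ ℤ.+ p₁ ℤ.- p₀ ≋ q₁ ℤ.+ q₁ ℤ.- q₀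
  extrapolate {p₁} {q₁} {p₀} {q₀} (mod d₁) (mod d₀) =
    mod (∣-resp (lem p₁ q₁ p₀ q₀) (∣m∣n⇒∣m-n (∣m∣n⇒∣m+n d₁ d₁) d₀))
    where
    lem : ∀ p₁ q₁ p₀ q₀ → (p₁ ℤ.- q₁) ℤ.+ (p₁ ℤ.- q₁) ℤ.- (p₀ ℤ.- q₀) ≡ p₁ ℤ.+ p₁ ℤ.- p₀ ℤ.- (q₁ ℤ.+ q₁ ℤ.- q₀)
    lem = solve-∀

  rimVertex : ℕ → Vertex n
  rimVertex i = pos outside (+ i)

  rim-skip : ∀ z → pos outside (z ℤ.+ 0ℤ) ≢ pos outside (z ℤ.+ + 2)
  rim-skip z eq with generic (ℤ.- + 2) 0ℤ (from-yes (2 ℕ.≤? 8)) ℕ.z≤n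
                       (∣-resp (lem z (+ k)) (divides-difference (pos-injective outside eq)))
    where
    lem : ∀ z k → z ℤ.+ 0ℤ ℤ.- (z ℤ.+ + 2) ≡ ℤ.- + 2 ℤ.+ 0ℤ ℤ.* k
    lem = solve-∀
  ... | () , _

  -- Were two consecutive rim edges sent to a turn, the octagon through that turn would pull back to
  -- a closed walk of length 8 through them, contrary to `straight-rim`.
  no-turn : ∀ z s w {d d′} → Turn d d′ →
            let c = origin s ; c₁ = move d c in
            to (pos outside (z ℤ.+ 0ℤ)) ≡ π n k′ w c →
            to (pos outside (z ℤ.+ + 1)) ≡ π n k′ w c₁ →
            ¬ to (pos outside (z ℤ.+ + 2)) ≡ π n k′ w (move d′ c₁)
  no-turn z s w t e₀ e₁ e₂ = straight-rim n k z generic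
    (subst₂ (λ x y → Walk (Adjacent n k) x y 6 _) (pull e₁) (pull e₂)
      (subst (Walk (Adjacent n k) _ _ 6) (pull e₀)
        (Walk-map from from-injective from-adjacent (octagon n k′ w s t))))
    where
    pull : ∀ {x y} → to x ≡ y → from y ≡ x
    pull refl = from-to _

  record Straight (z : ℤ) : Set where
    field
      side      : Side
      start     : ℤ
      speed     : ℤ
      speed-±   : speed ∈± jump k′ side
      to₀       : to (pos outside (z ℤ.+ 0ℤ)) ≡ pos side start
      to₁       : to (pos outside (z ℤ.+ + 1)) ≡ pos side (start ℤ.+ speed)
      to₂       : to (pos outside (z ℤ.+ + 2)) ≡ pos side (start ℤ.+ speed ℤ.+ speed)

  abstract
    -- Of the nine pairs of moves, three backtrack and contradict `rim-skip`, four are turns and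
    -- contradict `no-turn`; the two straight ones remain.
    straight : ∀ z → Straight z
    straight z with pos-surjective (to (pos outside (z ℤ.+ 0ℤ)))
    ... | s , w , eq = result
      where
      e₀ : to (pos outside (z ℤ.+ 0ℤ)) ≡ π n k′ w (origin s)
      e₀ = trans eq (cong (pos s) (sym (ℤ.+-identityʳ w)))
      adj₀ : Adjacent n k (pos outside (z ℤ.+ 0ℤ)) (pos outside (z ℤ.+ + 1))
      adj₀ = subst (λ y → Adjacent n k (pos outside (z ℤ.+ 0ℤ)) (pos outside y)) (lem z) (adjacent-jump k outside (z ℤ.+ 0ℤ))
        where
        lem : ∀ z → z ℤ.+ 0ℤ ℤ.+ 1ℤ ≡ z ℤ.+ + 1
        lem = solve-∀
      adj₁ : Adjacent n k (pos outside (z ℤ.+ + 1)) (pos outside (z ℤ.+ + 2))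
      adj₁ = subst (λ y → Adjacent n k (pos outside (z ℤ.+ + 1)) (pos outside y)) (lem z) (adjacent-jump k outside (z ℤ.+ + 1))
        where
        lem : ∀ z → z ℤ.+ + 1 ℤ.+ 1ℤ ≡ z ℤ.+ + 2
        lem = solve-∀
      distinct : ∀ d → to (pos outside (z ℤ.+ + 2)) ≢ π n k′ w (move (opposite d) (move d (origin s)))
      distinct d e₂ = rim-skip z (to-injective (trans e₀ (sym (trans e₂ (cong (π n k′ w) (move-opposite d (origin s)))))))

      classify : ∀ d d′ → to (pos outside (z ℤ.+ + 1)) ≡ π n k′ w (move d (origin s)) →
                 to (pos outside (z ℤ.+ + 2)) ≡ π n k′ w (move d′ (move d (origin s))) → Straight z
      classify forth forth e₁ e₂ = record
        { side = s ; start = w ; speed = jump k′ s ; speed-± = plus refl ; to₀ = eq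
        ; to₁ = trans e₁ (π-forth-origin s) ; to₂ = trans e₂ (π-forth²-origin s) }
        where
        lem₁ : ∀ w k → w ℤ.+ (0ℤ ℤ.+ 1ℤ ℤ.* k) ≡ w ℤ.+ k
        lem₁ = solve-∀
        lem₂ : ∀ w k → w ℤ.+ (0ℤ ℤ.+ + 2 ℤ.* k) ≡ w ℤ.+ k ℤ.+ k
        lem₂ = solve-∀
        lem₃ : ∀ w k → w ℤ.+ (+ 2 ℤ.+ 0ℤ ℤ.* k) ≡ w ℤ.+ 1ℤ ℤ.+ 1ℤ
        lem₃ = solve-∀
        π-forth-origin : ∀ s → π n k′ w (move forth (origin s)) ≡ pos s (w ℤ.+ jump k′ s)
        π-forth-origin outside = refl
        π-forth-origin inside  = cong (pos inside) (lem₁ w (+ k′))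
        π-forth²-origin : ∀ s → π n k′ w (move forth (move forth (origin s))) ≡ pos s (w ℤ.+ jump k′ s ℤ.+ jump k′ s)
        π-forth²-origin outside = cong (pos outside) (lem₃ w (+ k′))
        π-forth²-origin inside  = cong (pos inside) (lem₂ w (+ k′))
      classify back back e₁ e₂ = record
        { side = s ; start = w ; speed = ℤ.- jump k′ s ; speed-± = minus refl ; to₀ = eq
        ; to₁ = trans e₁ (π-back-origin s) ; to₂ = trans e₂ (π-back²-origin s) }
        where
        lem₁ : ∀ w k → w ℤ.+ (0ℤ ℤ.+ ℤ.- 1ℤ ℤ.* k) ≡ w ℤ.+ ℤ.- k
        lem₁ = solve-∀
        lem₂ : ∀ w k → w ℤ.+ (0ℤ ℤ.+ ℤ.- + 2 ℤ.* k) ≡ w ℤ.+ ℤ.- k ℤ.+ ℤ.- k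
        lem₂ = solve-∀
        lem₃ : ∀ w k → w ℤ.+ (ℤ.- + 2 ℤ.+ 0ℤ ℤ.* k) ≡ w ℤ.+ ℤ.- 1ℤ ℤ.+ ℤ.- 1ℤ
        lem₃ = solve-∀
        π-back-origin : ∀ s → π n k′ w (move back (origin s)) ≡ pos s (w ℤ.- jump k′ s)
        π-back-origin outside = refl
        π-back-origin inside  = cong (pos inside) (lem₁ w (+ k′))
        π-back²-origin : ∀ s → π n k′ w (move back (move back (origin s))) ≡ pos s (w ℤ.- jump k′ s ℤ.- jump k′ s)
        π-back²-origin outside = cong (pos outside) (lem₃ w (+ k′))
        π-back²-origin inside  = cong (pos inside) (lem₂ w (+ k′))
      classify forth back e₁ e₂ = ⊥-elim (distinct forth e₂)
      classify back forth e₁ e₂ = ⊥-elim (distinct back e₂)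
      classify across across e₁ e₂ = ⊥-elim (distinct across e₂)
      classify forth across e₁ e₂ = contradiction e₂ (no-turn z s w from-forth e₀ e₁)
      classify back across e₁ e₂ = contradiction e₂ (no-turn z s w from-back e₀ e₁)
      classify across forth e₁ e₂ = contradiction e₂ (no-turn z s w to-forth e₀ e₁)
      classify across back e₁ e₂ = contradiction e₂ (no-turn z s w to-back e₀ e₁)

      result : Straight z
      result =
        let d  , e₁ = neighbour-move n k′ w (origin s) (subst (λ y → Adjacent n k′ y _) e₀ (to-adjacent adj₀))
            d′ , e₂ = neighbour-move n k′ w (move d (origin s)) (subst (λ y → Adjacent n k′ y _) e₁ (to-adjacent adj₁))
        in classify d d′ e₁ e₂

  -- The image of the rim advances by `u` on `side`, that of an inner edge by `u′` on the other
  -- side. An inner edge spans `k` rim steps, hence `k*u≋u′`.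
  record RimImage : Set where
    field
      side   : Side
      start  : ℤ
      u u′   : ℤ
      u±     : u ∈± jump k′ side
      u′±    : u′ ∈± jump k′ (other side)
      to-rim : to (pos outside 0ℤ) ≡ pos side start
      k*u≋u′ : + k ℤ.* u ≋ u′

  module _ (st : Straight 0ℤ) where
    open Straight st
      renaming (side to s; start to w; speed to v; speed-± to v±; to₀ to to-0; to₁ to to-1)
      hiding (to₂)

    on-line : ℕ → ℤ
    on-line i = w ℤ.+ + i ℤ.* v

    OnLine : ℕ → Set
    OnLine i = to (rimVertex i) ≡ pos s (on-line i)

    -- The local segment at `i` agrees with the line in its first two positions modulo `n`, hence
    -- also in the third, which is their linear extrapolation.
    line-step : ∀ i → OnLine i → OnLine (suc i) → Straight (+ i) → OnLine (2 ℕ.+ i)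
    line-step i e₀ e₁ st = trans (cong to (cong (λ j → pos outside (+ j)) (ℕ.+-comm 2 i))) (trans S.to₂ next)
      where
      module S = Straight st
      f₀ : to (rimVertex i) ≡ pos S.side S.start
      f₀ = trans (cong to (cong (λ j → pos outside (+ j)) (sym (ℕ.+-identityʳ i)))) S.to₀
      f₁ : to (rimVertex (suc i)) ≡ pos S.side (S.start ℤ.+ S.speed)
      f₁ = trans (cong to (cong (λ j → pos outside (+ j)) (ℕ.+-comm 1 i))) S.to₁
      same : S.side ≡ s
      same = pos-sides S.side s (trans (sym f₀) e₀)
      A₀ : S.start ≋ on-line i
      A₀ = pos-injective s (trans (cong (λ t → pos t S.start) (sym same)) (trans (sym f₀) e₀))
      A₁ : S.start ℤ.+ S.speed ≋ on-line (suc i)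
      A₁ = pos-injective s (trans (cong (λ t → pos t (S.start ℤ.+ S.speed)) (sym same)) (trans (sym f₁) e₁))
      A₂ : S.start ℤ.+ S.speed ℤ.+ S.speed ≋ on-line (suc (suc i))
      A₂ = subst₂ _≋_ (lem₂ S.start S.speed) (lem₃ w v (+ i)) (extrapolate A₁ A₀)
        where
        lem₂ : ∀ w v → w ℤ.+ v ℤ.+ (w ℤ.+ v) ℤ.- w ≡ w ℤ.+ v ℤ.+ v
        lem₂ = solve-∀
        lem₃ : ∀ w v i → w ℤ.+ (1ℤ ℤ.+ i) ℤ.* v ℤ.+ (w ℤ.+ (1ℤ ℤ.+ i) ℤ.* v) ℤ.- (w ℤ.+ i ℤ.* v) ≡ w ℤ.+ (+ 2 ℤ.+ i) ℤ.* v
        lem₃ = solve-∀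
      next : pos S.side (S.start ℤ.+ S.speed ℤ.+ S.speed) ≡ pos s (on-line (suc (suc i)))
      next = trans (cong (λ t → pos t (S.start ℤ.+ S.speed ℤ.+ S.speed)) same) (pos-cong s A₂)

    line : ∀ i → OnLine i × OnLine (suc i)
    line zero = trans to-0 (cong (pos s) (lem₀ w v)) , trans to-1 (cong (pos s) (lem₁ w v))
      where
      lem₀ : ∀ w v → w ≡ w ℤ.+ 0ℤ ℤ.* v
      lem₀ = solve-∀
      lem₁ : ∀ w v → w ℤ.+ v ≡ w ℤ.+ 1ℤ ℤ.* v
      lem₁ = solve-∀
    line (suc i) = let e₀ , e₁ = line i in e₁ , line-step i e₀ e₁ (straight (+ i))

    -- Of the three neighbours of the image of a rim vertex, the two along the line are images of
    -- rim vertices, so injectivity leaves only the far end of the spoke. Starting at index 1 keeps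
    -- the preceding rim vertex at a natural index.
    spokes : ∀ i → to (pos inside (+ suc i)) ≡ pos (other s) (on-line (suc i))
    spokes i with neighbour k′ s (on-line (suc i))
                    (subst (λ y → Adjacent n k′ y _) (proj₂ (line i)) (to-adjacent (adjacent-spoke k outside (+ suc i))))
    ... | inj₂ eq = eq
    ... | inj₁ (v′ , v′± , eq) with ∈±-compare v± v′±
    ...   | plus refl  = contradiction
      (to-injective (trans (proj₂ (line (suc i))) (trans (cong (pos s) (sym (lem w v (+ i)))) (sym eq)))) λ ()
      where
      lem : ∀ w v i → w ℤ.+ (1ℤ ℤ.+ i) ℤ.* v ℤ.+ v ≡ w ℤ.+ (+ 2 ℤ.+ i) ℤ.* v
      lem = solve-∀
    ...   | minus refl = contradiction
      (to-injective (trans (proj₁ (line i)) (trans (cong (pos s) (sym (lem w v (+ i)))) (sym eq)))) λ ()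
      where
      lem : ∀ w v i → w ℤ.+ (1ℤ ℤ.+ i) ℤ.* v ℤ.+ ℤ.- v ≡ w ℤ.+ i ℤ.* v
      lem = solve-∀

    rimImage-along : RimImage
    -- The inner edge from index 1 to index 1 + k is used, as `spokes` starts at 1. Its image stays
    -- on one side, so it is no spoke.
    rimImage-along with neighbour k′ (other s) (on-line 1)
                    (subst₂ (Adjacent n k′) (spokes 0) (spokes k) (to-adjacent (adjacent-jump k inside (+ 1))))
    ... | inj₁ (v′ , v′± , eq) = record
      { side = s ; start = w ; u = v ; u′ = v′ ; u± = v± ; u′± = v′± ; to-rim = to-0
      ; k*u≋u′ = ≋-resp (lem w v v′ (+ k)) (pos-injective (other s) eq) }
      where
      lem : ∀ w v v′ k → w ℤ.+ (1ℤ ℤ.+ k) ℤ.* v ℤ.- (w ℤ.+ 1ℤ ℤ.* v ℤ.+ v′) ≡ k ℤ.* v ℤ.- v′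
      lem = solve-∀
    ... | inj₂ eq = contradiction eq (pos-disjoint (other s))

  abstract
    rimImage : RimImage
    rimImage = rimImage-along (straight 0ℤ)

-- Composing similarities; similarities from isomorphisms

Similarity-refl : ∀ {p} → Similarity p p
Similarity-refl = record
  { to = λ x → x ; from = λ x → x ; to-from = λ _ → refl ; from-to = λ _ → refl
  ; to-adjacent = λ p → p ; from-adjacent = λ p → p }

Similarity-sym : ∀ {p q} → Similarity p q → Similarity q p
Similarity-sym φ = record
  { to = φ.from ; from = φ.to ; to-from = φ.from-to ; from-to = φ.to-from
  ; to-adjacent = φ.from-adjacent ; from-adjacent = φ.to-adjacent }
  where module φ = Similarity φ

Similarity-trans : ∀ {p q r} → Similarity p q → Similarity q r → Similarity p r
Similarity-trans φ ψ = record
  { to = λ x → ψ.to (φ.to x) ; from = λ x → φ.from (ψ.from x)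
  ; to-from = λ y → trans (cong ψ.to (φ.to-from _)) (ψ.to-from y)
  ; from-to = λ x → trans (cong φ.from (ψ.from-to _)) (φ.from-to x)
  ; to-adjacent = λ p → ψ.to-adjacent (φ.to-adjacent p)
  ; from-adjacent = λ p → φ.from-adjacent (ψ.from-adjacent p) }
  where
  module φ = Similarity φ
  module ψ = Similarity ψ

module _ {V V′ : Set} where

  ≈ᵤ-map : ∀ (f : V → V′) {x y u v} → (x , y) ≈ᵤ (u , v) → (f x , f y) ≈ᵤ (f u , f v)
  ≈ᵤ-map f (inj₁ (p , q)) = inj₁ (cong f p , cong f q)
  ≈ᵤ-map f (inj₂ (p , q)) = inj₂ (cong f p , cong f q)

≈ᵤ-trans : ∀ {V : Set} {p q r : V × V} → p ≈ᵤ q → q ≈ᵤ r → p ≈ᵤ r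
≈ᵤ-trans (inj₁ (refl , refl)) q                    = q
≈ᵤ-trans (inj₂ (refl , refl)) (inj₁ (refl , refl)) = inj₂ (refl , refl)
≈ᵤ-trans (inj₂ (refl , refl)) (inj₂ (refl , refl)) = inj₁ (refl , refl)

≈ᵤ-sym : ∀ {V : Set} {p q : V × V} → p ≈ᵤ q → q ≈ᵤ p
≈ᵤ-sym (inj₁ (refl , refl)) = inj₁ (refl , refl)
≈ᵤ-sym (inj₂ (refl , refl)) = inj₂ (refl , refl)

≃⇒Similarity : ∀ {p q} → p ≃ q → Similarity p q
≃⇒Similarity {n , k} {n′ , k′} iso = record
  { to = v.to ; from = v.from
  ; to-from = v.strictlyInverseˡ ; from-to = v.strictlyInverseʳ
  ; to-adjacent = λ { (e joins p) → ε.to e joins ≈ᵤ-trans (≈ᵤ-sym (preserves-ends e)) (≈ᵤ-map v.to p) }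
  ; from-adjacent = λ { (e joins p) → ε.from e joins
      ≈ᵤ-trans (inj₁ (sym (v.strictlyInverseʳ _) , sym (v.strictlyInverseʳ _)))
        (≈ᵤ-map v.from (≈ᵤ-trans (preserves-ends (ε.from e))
          (subst (λ e′ → petersenEnds n′ k′ e′ ≈ᵤ _) (sym (ε.strictlyInverseˡ e)) p))) }
  }
  where
  open _≅_ iso
  module v = Inverse vertices
  module ε = Inverse edges

-- Pigeonhole on the n + n vertices.
Similarity⇒order-≤ : ∀ {n k n′ k′} → Similarity (n , k) (n′ , k′) → n ℕ.≤ n′
Similarity⇒order-≤ {n} {_} {n′} φ with n ℕ.≤? n′
... | yes n≤n′ = n≤n′
... | no  n≰n′ = contradiction (injective⇒≤ {f = λ i → join n′ n′ (to (splitAt n i))} inj)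
                   (ℕ.<⇒≱ (ℕ.+-mono-< (ℕ.≰⇒> n≰n′) (ℕ.≰⇒> n≰n′)))
  where
  open Similarity φ
  inj : ∀ {i j} → join n′ n′ (to (splitAt n i)) ≡ join n′ n′ (to (splitAt n j)) → i ≡ j
  inj {i} {j} eq = trans (sym (join-splitAt n n i)) (trans (cong (join n n) (to-injective
    (trans (sym (splitAt-join n′ n′ _)) (trans (cong (splitAt n′) eq) (splitAt-join n′ n′ _)))))
    (join-splitAt n n j))

Similarity⇒order-≡ : ∀ {n k n′ k′} → Similarity (n , k) (n′ , k′) → n ≡ n′
Similarity⇒order-≡ φ = ℕ.≤-antisym (Similarity⇒order-≤ φ) (Similarity⇒order-≤ (Similarity-sym φ))

-- Congruences for k from isomorphisms and from Cayley structures

module _ (n : ℕ) {{_ : NonZero n}} where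
  open Residues n

  *-∈± : ∀ k {u u′ x y} → u ∈± x → u′ ∈± y → k ℤ.* u ≋ u′ → ∃[ y′ ] y′ ∈± y × k ℤ.* x ≋ y′
  *-∈± k (plus refl) q p = _ , q , p
  *-∈± k {_} {u′} {x} (minus refl) q p =
    ℤ.- u′ , neg-∈± q , mod (∣-resp (lem k x u′) (∣m⇒∣-m (divides-difference p)))
    where
    lem : ∀ k x u′ → ℤ.- (k ℤ.* ℤ.- x ℤ.- u′) ≡ k ℤ.* x ℤ.- ℤ.- u′
    lem = solve-∀

  -- If the rim maps to the rim then k ≡ ±k′, and since k and k′ lie below n/2 the sign is plus and
  -- equality holds. If it maps inside then k k′ ≡ ±1, impossible by parity.
  similar-even⇒≡ : ∀ {k k′} → Generic n k → 2 ℕ.∣ n → 2 ℕ.∣ k → 1 ℕ.≤ k →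
                   2 ℕ.* k ℕ.< n → 2 ℕ.* k′ ℕ.< n → Similarity (n , k) (n , k′) → k ≡ k′
  similar-even⇒≡ {k} {k′} gen 2∣n 2∣k 1≤k 2k<n 2k′<n φ = conclude R.side R.u± R.u′±
    where
    module R = RimImage (rimImage n gen φ)
    k<n : k ℕ.< n
    k<n = ℕ.≤-<-trans (ℕ.m≤m+n k _) 2k<n
    k′<n : k′ ℕ.< n
    k′<n = ℕ.≤-<-trans (ℕ.m≤m+n k′ _) 2k′<n
    k+k′<n : k ℕ.+ k′ ℕ.< n
    k+k′<n = ℕ.*-cancelˡ-< 2 _ _ (subst₂ ℕ._<_ (sym (ℕ.*-distribˡ-+ 2 k k′)) (cong (n ℕ.+_) (sym (ℕ.+-identityʳ n)))
               (ℕ.+-mono-< 2k<n 2k′<n))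
    even-unit : ∀ {v} x → v ∈± 1ℤ → ¬ + k ℤ.* x ≋ v
    even-unit {v} x v± (mod d) = impossible v± (∣-resp (lem (+ k) x v)
        (∣m∣n⇒∣m-n (∣n⇒∣m*n x (∣ᵤ⇒∣ 2∣k)) (∣-trans (∣ᵤ⇒∣ {+ 2} {+ n} 2∣n) d)))
      where
      lem : ∀ k x v → x ℤ.* k ℤ.- (k ℤ.* x ℤ.- v) ≡ v
      lem = solve-∀
      impossible : ∀ {v} → v ∈± 1ℤ → ¬ + 2 ∣ v
      impossible (plus refl)  2∣v = from-no (2 ℕ.∣? 1) (∣⇒∣ᵤ 2∣v)
      impossible (minus refl) 2∣v = from-no (2 ℕ.∣? 1) (∣⇒∣ᵤ 2∣v)
    conclude : ∀ s → R.u ∈± jump k′ s → R.u′ ∈± jump k′ (other s) → k ≡ k′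
    conclude outside u± u′± with *-∈± (+ k) u± u′± R.k*u≋u′
    ... | _ , plus refl  , p = ℤ.+-injective (ℤ.i-j≡0⇒i≡j _ _ (multiple-below⇒0
          (subst (λ z → + n ∣ z ℤ.- + k′) (ℤ.*-identityʳ (+ k)) (divides-difference p)) (∣+m-+n∣<o k<n k′<n)))
    ... | _ , minus refl , p = contradiction
          (ℕ.m+n≡0⇒m≡0 k (ℤ.+-injective (multiple-below⇒0 (∣-resp (lem (+ k) (+ k′)) (divides-difference p)) k+k′<n)))
          (ℕ.>⇒≢ 1≤k)
      where
      lem : ∀ k k′ → k ℤ.* 1ℤ ℤ.- ℤ.- k′ ≡ k ℤ.+ k′
      lem = solve-∀
    conclude inside  u± u′± with *-∈± (+ k) u± u′± R.k*u≋u′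
    ... | _ , v± , p = contradiction p (even-unit (+ k′) v±)

  module _ {k : ℕ} where
    open CayleyDecision (⊎-finite Fin-finite Fin-finite)
      (⊎-finite Fin-finite (⊎-finite Fin-finite Fin-finite)) (petersenEnds n k)
      using (Good; fromCayley)

    Translation : Set
    Translation = Σ[ φ ∈ Similarity (n , k) (n , k) ] Similarity.to φ (pos outside 0ℤ) ≡ pos inside 0ℤ

    -- The translation is left multiplication by b₀ a₀⁻¹.
    good⇒translation : ∃[ x ] Good x → Translation
    good⇒translation ((m , e , inv) , assoc , (identityˡ , identityʳ) , (inverseˡ , inverseʳ) , translate) = record
      { to = λ x → m (g , x) ; from = λ x → m (inv g , x)
      ; to-from = λ y → trans (sym (assoc g (inv g) y)) (trans (cong (λ h → m (h , y)) (inverseʳ g)) (identityˡ y))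
      ; from-to = λ x → trans (sym (assoc (inv g) g x)) (trans (cong (λ h → m (h , x)) (inverseˡ g)) (identityˡ x))
      ; to-adjacent = moved g ; from-adjacent = moved (inv g) }
      , trans (assoc _ _ _) (trans (cong (λ h → m (pos inside 0ℤ , h)) (inverseˡ _)) (identityʳ _))
      where
      g = m (pos inside 0ℤ , inv (pos outside 0ℤ))
      moved : ∀ h {x y} → Adjacent n k x y → Adjacent n k (m (h , x)) (m (h , y))
      moved h (ed joins p) with translate ed h
      ... | ed′ , q = ed′ joins ≈ᵤ-trans q (≈ᵤ-map (λ x → m (h , x)) p)

    abstract
      translation : Cayley (n , k) → Translation
      translation cay = good⇒translation (proj₂ (fromCayley cay))

  -- As a₀ goes to b₀, the rim lands inside; there `u` is ±k and `u′` is ±1.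
  Cayley⇒square-±1 : ∀ {k} → Generic n k → Cayley (n , k) → ∃[ c ] c ∈± 1ℤ × + k ℤ.* + k ≋ c
  Cayley⇒square-±1 {k} gen cay with translation cay
  ... | φ , a₀↦b₀ = conclude R.side R.u± R.u′± (pos-sides R.side inside (trans (sym R.to-rim) a₀↦b₀))
    where
    module R = RimImage (rimImage n gen φ)
    conclude : ∀ s → R.u ∈± jump k s → R.u′ ∈± jump k (other s) → s ≡ inside → ∃[ c ] c ∈± 1ℤ × + k ℤ.* + k ≋ c
    conclude inside u± u′± refl = *-∈± (+ k) u± u′± R.k*u≋u′

-- Pairs satisfying a relation modulo n

signed : Fin 2 → ℕ → ℤ
signed zero       m = + m
signed (suc zero) m = ℤ.- + m

∣signed∣ : ∀ t m → ℤ.∣ signed t m ∣ ≡ m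
∣signed∣ zero       m = refl
∣signed∣ (suc zero) m = ℤ.∣-i∣≡∣i∣ (+ m)

-- Codes for the integers of absolute value at most 8 by sign and magnitude. Zero has two codes,
-- which does no harm in an upper bound.
Small : Set
Small = Fin 2 × Fin 9

⟦_⟧ : Small → ℤ
⟦ t , i ⟧ = signed t (toℕ i)

∣⟦⟧∣≤8 : ∀ x → ℤ.∣ ⟦ x ⟧ ∣ ℕ.≤ 8
∣⟦⟧∣≤8 (t , i) = subst (ℕ._≤ 8) (sym (∣signed∣ t (toℕ i))) (toℕ≤pred[n] i)

⟦⟧-surjective : ∀ α → ℤ.∣ α ∣ ℕ.≤ 8 → ∃[ x ] ⟦ x ⟧ ≡ α
⟦⟧-surjective (+ m)    m≤8 = (zero , fromℕ< (s≤s m≤8)) , cong +_ (toℕ-fromℕ< (s≤s m≤8))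
⟦⟧-surjective -[1+ m ] m≤8 = (suc zero , fromℕ< (s≤s m≤8)) , cong (λ m → ℤ.- + m) (toℕ-fromℕ< (s≤s m≤8))

-- On the left, the coefficients of a linear relation; on the right, the sign in k² ≡ ±1 and the
-- residue of k modulo 3.
Label : Set
Label = (Small × Small) ⊎ (Fin 2 × Fin 3)

LinearRelation : ℕ → ℕ → Small → Small → Set
LinearRelation n k x y = ¬ (⟦ x ⟧ ≡ 0ℤ × ⟦ y ⟧ ≡ 0ℤ) × + n ∣ ⟦ x ⟧ ℤ.+ ⟦ y ⟧ ℤ.* + k

-- Recording k mod 3 excludes the solutions k and k ± 2 of k² ≡ 1, which
-- lie in a common window when n divides 4 (k ± 1).
Holds : ℕ → ℕ → Label → Set
Holds n k (inj₁ (x , y)) = LinearRelation n k x y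
Holds n k (inj₂ (t , r)) = k mod 3 ≡ r × + n ∣ + k ℤ.* + k ℤ.- signed t 1

linearRelation? : ∀ n k x y → Dec (LinearRelation n k x y)
linearRelation? n k x y =
  ¬? (⟦ x ⟧ ℤ.≟ 0ℤ ×-dec ⟦ y ⟧ ℤ.≟ 0ℤ) ×-dec + n ∣? ⟦ x ⟧ ℤ.+ ⟦ y ⟧ ℤ.* + k

-- Decided by searching the finitely many coded coefficients.
Generic⊎LinearRelation : ∀ n k → Generic n k ⊎ (∃[ x ] ∃[ y ] LinearRelation n k x y)
Generic⊎LinearRelation n k with any? (λ t → any? λ i → any? λ u → any? λ j → linearRelation? n k (t , i) (u , j))
... | yes (t , i , u , j , r) = inj₂ ((t , i) , (u , j) , r)
... | no none = inj₁ generic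
  where
  generic : Generic n k
  generic α β α≤8 β≤8 n∣ with ⟦⟧-surjective α α≤8 | ⟦⟧-surjective β β≤8
  ... | (t , i) , refl | (u , j) , refl with ⟦ t , i ⟧ ℤ.≟ 0ℤ | ⟦ u , j ⟧ ℤ.≟ 0ℤ
  ...   | yes p | yes q = p , q
  ...   | no ¬p | _     = ⊥-elim (none (t , i , u , j , (λ (p , _) → ¬p p) , n∣))
  ...   | _     | no ¬q = ⊥-elim (none (t , i , u , j , (λ (_ , q) → ¬q q) , n∣))

Cayley⇒Holds : ∀ n k → {{NonZero n}} → Cayley (n , k) → ∃[ ℓ ] Holds n k ℓ
Cayley⇒Holds n k cay with Generic⊎LinearRelation n k
... | inj₂ (x , y , r) = inj₁ (x , y) , r
... | inj₁ gen with Cayley⇒square-±1 n gen cay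
...   | c , plus refl  , p = inj₂ (zero , k mod 3) , refl , Residues.divides-difference p
...   | c , minus refl , p = inj₂ (suc zero , k mod 3) , refl , Residues.divides-difference p

+[m%n+[m/n]*n] : ∀ m d {{_ : NonZero d}} → + m ≡ + (m % d) ℤ.+ + (m ℕ./ d) ℤ.* + d
+[m%n+[m/n]*n] m d = trans (cong +_ (m≡m%n+[m/n]*n m d)) (cong (λ q → + (m % d) ℤ.+ q) (ℤ.pos-* (m ℕ./ d) d))

≡mod⇒∣ : ∀ m m′ d {{_ : NonZero d}} → m mod d ≡ m′ mod d → + d ∣ + m ℤ.- + m′
≡mod⇒∣ m m′ d eq = divides (+ (m ℕ./ d) ℤ.- + (m′ ℕ./ d))
  (trans (cong₂ ℤ._-_ (trans (+[m%n+[m/n]*n] m d) (cong (λ r → + r ℤ.+ + (m ℕ./ d) ℤ.* + d) same)) (+[m%n+[m/n]*n] m′ d))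
         (lem (+ (m′ % d)) (+ (m ℕ./ d)) (+ (m′ ℕ./ d)) (+ d)))
  where
  same : m % d ≡ m′ % d
  same = trans (sym (toℕ-fromℕ< (m%n<n m d))) (trans (cong toℕ eq) (toℕ-fromℕ< (m%n<n m′ d)))
  lem : ∀ r q q′ d → r ℤ.+ q ℤ.* d ℤ.- (r ℤ.+ q′ ℤ.* d) ≡ (q ℤ.- q′) ℤ.* d
  lem = solve-∀

same-window⇒close : ∀ m m′ d {{_ : NonZero d}} → m ℕ./ d ≡ m′ ℕ./ d → ℤ.∣ + m ℤ.- + m′ ∣ ℕ.< d
same-window⇒close m m′ d eq = subst (λ z → ℤ.∣ z ∣ ℕ.< d) (sym difference) (∣+m-+n∣<o (m%n<n m d) (m%n<n m′ d))
  where
  lem : ∀ r r′ q d → r ℤ.+ q ℤ.* d ℤ.- (r′ ℤ.+ q ℤ.* d) ≡ r ℤ.- r′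
  lem = solve-∀
  difference : + m ℤ.- + m′ ≡ + (m % d) ℤ.- + (m′ % d)
  difference = trans
    (cong₂ ℤ._-_ (trans (+[m%n+[m/n]*n] m d) (cong (λ q → + (m % d) ℤ.+ + q ℤ.* + d) eq)) (+[m%n+[m/n]*n] m′ d))
    (lem (+ (m % d)) (+ (m′ % d)) (+ (m′ ℕ./ d)) (+ d))

∣4c∣≡4 : ∀ c → ℤ.∣ c ∣ ≡ 1 → ℤ.∣ + 4 ℤ.* c ∣ ≡ 4
∣4c∣≡4 c ∣c∣≡1 = trans (ℤ.abs-* (+ 4) c) (cong (4 ℕ.*_) ∣c∣≡1)

-- Eliminating k + k′ from k² ≡ c and k′² ≡ c leaves d² (4c − d²) ≡ 0 for d = k − k′.
∣d²[4c-d²] : ∀ {i} k k′ c → i ∣ k ℤ.* k ℤ.- c → i ∣ k′ ℤ.* k′ ℤ.- c →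
             i ∣ (k ℤ.- k′) ℤ.* (k ℤ.- k′) ℤ.* (+ 4 ℤ.* c ℤ.- (k ℤ.- k′) ℤ.* (k ℤ.- k′))
∣d²[4c-d²] k k′ c p p′ = ∣-resp (elimination k k′ c)
  -- This combination is (u - v)² - 2e²(u + v). With s = k + k′ one has u - v = e s and 2(u + v) =
  -- s² + e² - 4c, so s² cancels.
  (∣m∣n⇒∣m-n (∣n⇒∣m*n (u ℤ.- v ℤ.- + 2 ℤ.* (e ℤ.* e)) p) (∣n⇒∣m*n (u ℤ.- v ℤ.+ + 2 ℤ.* (e ℤ.* e)) p′))
  where
  u = k ℤ.* k ℤ.- c
  v = k′ ℤ.* k′ ℤ.- c
  e = k ℤ.- k′
  elimination : ∀ k k′ c →
    let u = k ℤ.* k ℤ.- c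
        v = k′ ℤ.* k′ ℤ.- c
        e = k ℤ.- k′
    in (u ℤ.- v ℤ.- + 2 ℤ.* (e ℤ.* e)) ℤ.* u ℤ.- (u ℤ.- v ℤ.+ + 2 ℤ.* (e ℤ.* e)) ℤ.* v ≡ e ℤ.* e ℤ.* (+ 4 ℤ.* c ℤ.- e ℤ.* e)
  elimination = solve-∀

∣d²[4c-d²]∣≤ : ∀ {D} c d → ℤ.∣ c ∣ ≡ 1 → ℤ.∣ d ∣ ℕ.≤ D →
               ℤ.∣ d ℤ.* d ℤ.* (+ 4 ℤ.* c ℤ.- d ℤ.* d) ∣ ℕ.≤ D ℕ.* D ℕ.* (4 ℕ.+ D ℕ.* D)
∣d²[4c-d²]∣≤ {D} c d ∣c∣≡1 ∣d∣≤D = begin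
  ℤ.∣ d ℤ.* d ℤ.* (+ 4 ℤ.* c ℤ.- d ℤ.* d) ∣        ≡⟨ ℤ.abs-* (d ℤ.* d) (+ 4 ℤ.* c ℤ.- d ℤ.* d) ⟩
  ℤ.∣ d ℤ.* d ∣ ℕ.* ℤ.∣ + 4 ℤ.* c ℤ.- d ℤ.* d ∣    ≤⟨ ℕ.*-mono-≤ d²≤D² (ℕ.≤-trans (ℤ.∣i-j∣≤∣i∣+∣j∣ (+ 4 ℤ.* c) (d ℤ.* d))
                                                        (ℕ.+-mono-≤ (ℕ.≤-reflexive (∣4c∣≡4 c ∣c∣≡1)) d²≤D²)) ⟩
  D ℕ.* D ℕ.* (4 ℕ.+ D ℕ.* D)                      ∎
  where
  open ℕ.≤-Reasoning
  d²≤D² : ℤ.∣ d ℤ.* d ∣ ℕ.≤ D ℕ.* D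
  d²≤D² = subst (ℕ._≤ D ℕ.* D) (sym (ℤ.abs-* d d)) (ℕ.*-mono-≤ ∣d∣≤D ∣d∣≤D)

-- If d² were 4c, then 3 would divide 4.
d²[4c-d²]≡0⇒d≡0 : ∀ c d → ℤ.∣ c ∣ ≡ 1 → + 3 ∣ d → d ℤ.* d ℤ.* (+ 4 ℤ.* c ℤ.- d ℤ.* d) ≡ 0ℤ → d ≡ 0ℤ
d²[4c-d²]≡0⇒d≡0 c d ∣c∣≡1 3∣d eq with ℤ.i*j≡0⇒i≡0∨j≡0 (d ℤ.* d) eq
... | inj₂ 4c-d²≡0 = contradiction
  (∣⇒∣ᵤ (subst (+ 3 ∣_) (sym (ℤ.i-j≡0⇒i≡j (+ 4 ℤ.* c) (d ℤ.* d) 4c-d²≡0)) (∣n⇒∣m*n d 3∣d)))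
  λ 3∣4c → from-no (3 ℕ.∣? 4) (subst (3 ℕ.∣_) (∣4c∣≡4 c ∣c∣≡1) 3∣4c)
... | inj₁ d²≡0 with ℤ.i*j≡0⇒i≡0∨j≡0 d d²≡0
...   | inj₁ d≡0 = d≡0
...   | inj₂ d≡0 = d≡0

-- The summands bound |α|, |β d| and |d² (4c - d²)| for |d| ≤ D; for n at least their sum, each of
-- these quantities vanishes as soon as n divides it.
threshold : ℕ → ℕ
threshold D = 9 ℕ.+ 8 ℕ.* D ℕ.+ D ℕ.* D ℕ.* (4 ℕ.+ D ℕ.* D)

module _ {D n : ℕ} (large : threshold D ℕ.≤ n) {k k′ : ℕ} (close : ℤ.∣ + k ℤ.- + k′ ∣ ℕ.< D) where
  private
    d : ℤ
    d = + k ℤ.- + k′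

    ∣d∣≤D : ℤ.∣ d ∣ ℕ.≤ D
    ∣d∣≤D = ℕ.<⇒≤ close

  -- Subtracting the relations gives β d ≡ 0, hence β d = 0. If β = 0, then α ≡ 0 forces α = 0 and
  -- the relation is trivial.
  linear-isolated : ∀ x y → LinearRelation n k x y → LinearRelation n k′ x y → d ≡ 0ℤ
  linear-isolated x y (nz , p) (_ , p′)
    with ℤ.i*j≡0⇒i≡0∨j≡0 ⟦ y ⟧
           (multiple-below⇒0 (∣-resp (lem ⟦ x ⟧ ⟦ y ⟧ (+ k) (+ k′)) (∣m∣n⇒∣m-n p p′)) bound)
    where
    lem : ∀ α β k k′ → α ℤ.+ β ℤ.* k ℤ.- (α ℤ.+ β ℤ.* k′) ≡ β ℤ.* (k ℤ.- k′)
    lem = solve-∀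
    open ℕ.≤-Reasoning
    bound : ℤ.∣ ⟦ y ⟧ ℤ.* d ∣ ℕ.< n
    bound = begin-strict
      ℤ.∣ ⟦ y ⟧ ℤ.* d ∣          ≡⟨ ℤ.abs-* ⟦ y ⟧ d ⟩
      ℤ.∣ ⟦ y ⟧ ∣ ℕ.* ℤ.∣ d ∣    ≤⟨ ℕ.*-mono-≤ (∣⟦⟧∣≤8 y) ∣d∣≤D ⟩
      8 ℕ.* D                    <⟨ s≤s (ℕ.m≤n+m (8 ℕ.* D) 8) ⟩
      9 ℕ.+ 8 ℕ.* D              ≤⟨ ℕ.m≤m+n _ _ ⟩
      threshold D                ≤⟨ large ⟩
      n                          ∎
  ... | inj₂ d≡0 = d≡0
  ... | inj₁ β≡0 = contradiction (α≡0 , β≡0) nz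
    where
    open ℕ.≤-Reasoning
    bound : ℤ.∣ ⟦ x ⟧ ∣ ℕ.< n
    bound = begin-strict
      ℤ.∣ ⟦ x ⟧ ∣      <⟨ s≤s (∣⟦⟧∣≤8 x) ⟩
      9                ≤⟨ ℕ.m≤m+n 9 _ ⟩
      9 ℕ.+ 8 ℕ.* D    ≤⟨ ℕ.m≤m+n _ _ ⟩
      threshold D      ≤⟨ large ⟩
      n                ∎
    lem : ∀ α β k → β ≡ 0ℤ → α ℤ.+ β ℤ.* k ≡ α
    lem α _ k refl = ℤ.+-identityʳ α
    α≡0 : ⟦ x ⟧ ≡ 0ℤ
    α≡0 = multiple-below⇒0 (∣-resp (lem ⟦ x ⟧ ⟦ y ⟧ (+ k) β≡0) p) bound

  square-isolated : ∀ c → ℤ.∣ c ∣ ≡ 1 → + 3 ∣ d → + n ∣ + k ℤ.* + k ℤ.- c → + n ∣ + k′ ℤ.* + k′ ℤ.- c → d ≡ 0ℤ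
  square-isolated c ∣c∣≡1 3∣d p p′ =
    d²[4c-d²]≡0⇒d≡0 c d ∣c∣≡1 3∣d (multiple-below⇒0 (∣d²[4c-d²] (+ k) (+ k′) c p p′)
      (ℕ.≤-<-trans (∣d²[4c-d²]∣≤ c d ∣c∣≡1 ∣d∣≤D)
        (ℕ.<-≤-trans (ℕ.m<n+m (D ℕ.* D ℕ.* (4 ℕ.+ D ℕ.* D)) (s≤s z≤n)) large)))

  isolated : ∀ ℓ → Holds n k ℓ → Holds n k′ ℓ → k ≡ k′
  isolated ℓ h h′ = ℤ.+-injective (ℤ.i-j≡0⇒i≡j (+ k) (+ k′) (d≡0 ℓ h h′))
    where
    d≡0 : ∀ ℓ → Holds n k ℓ → Holds n k′ ℓ → d ≡ 0ℤ
    d≡0 (inj₁ (x , y)) r r′ = linear-isolated x y r r′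
    d≡0 (inj₂ (t , r)) (k≡r , p) (k′≡r , p′) =
      square-isolated (signed t 1) (∣signed∣ t 1) (≡mod⇒∣ k k′ 3 (trans k≡r (sym k′≡r))) p p′

-- Counting isomorphism classes

lookup-injective : ∀ {X : Set} {xs : List X} → Unique xs → ∀ i j → lookup xs i ≡ lookup xs j → i ≡ j
lookup-injective (_ ∷ _)  zero    zero    _  = refl
lookup-injective {xs = x ∷ xs} (x∉ ∷ _)  zero    (suc j) eq = contradiction eq (All.lookup x∉ (∈-lookup j))
lookup-injective {xs = x ∷ xs} (x∉ ∷ _)  (suc i) zero    eq = contradiction (sym eq) (All.lookup x∉ (∈-lookup i))
lookup-injective (_ ∷ u)  (suc i) (suc j) eq = cong suc (lookup-injective u i j eq)

-- The code may depend on the membership proof; below, that proof supplies the Cayley structure from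
-- which a label is read off.
length≤size : ∀ {X T : Set} {xs : List X} → Unique xs → (fin : FiniteSet T) →
              (code : ∀ {x} → x ∈ xs → T) →
              (∀ {x y} (p : x ∈ xs) (q : y ∈ xs) → code p ≡ code q → x ≡ y) →
              length xs ℕ.≤ Finite.size fin
length≤size {xs = xs} u fin code code-injective =
  injective⇒≤ {f = λ i → idx (code (∈-lookup {xs = xs} i))} λ {i} {j} eq →
    lookup-injective u i j (code-injective (∈-lookup i) (∈-lookup j)
      (trans (sym (enum-idx _)) (trans (cong enum eq) (enum-idx _))))
  where open Finite fin

Label-finite : FiniteSet Label
Label-finite = ⊎-finite (×-finite≡ Small-finite Small-finite) (×-finite≡ Fin-finite Fin-finite)
  where
  Small-finite : FiniteSet Small
  Small-finite = ×-finite≡ Fin-finite Fin-finite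

abstract
  -- Opaque, so that the numeral is never expanded; the estimates work for any constant.
  #labels : ℕ
  #labels = Finite.size Label-finite

  #labels-def : Finite.size Label-finite ≡ #labels
  #labels-def = refl

∈-pairsUpTo⁻ : ∀ N {p} → p ∈ pairsUpTo N → proj₁ p ℕ.< suc N × proj₂ p ℕ.< suc N × Admissible p
∈-pairsUpTo⁻ N p∈ with ∈-filter⁻ admissible? {xs = cartesianProduct (upTo (suc N)) (upTo (suc N))} p∈
... | p∈× , adm with ∈-cartesianProduct⁻ (upTo (suc N)) (upTo (suc N)) p∈×
...   | n∈ , k∈ = ∈-upTo⁻ n∈ , ∈-upTo⁻ k∈ , adm

∈-pairsUpTo⁺ : ∀ N {n k} → n ℕ.≤ N → Admissible (n , k) → (n , k) ∈ pairsUpTo N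
∈-pairsUpTo⁺ N {n} {k} n≤N adm@(_ , _ , 2k≤n) = ∈-filter⁺ admissible?
  (∈-cartesianProduct⁺ (∈-upTo⁺ (s≤s n≤N)) (∈-upTo⁺ (s≤s (ℕ.≤-trans (ℕ.≤-trans (ℕ.m≤m+n k _) 2k≤n) n≤N)))) adm

pairsUpTo-unique : ∀ N → Unique (pairsUpTo N)
pairsUpTo-unique N = Unique.filter⁺ admissible? (Unique.cartesianProduct⁺ (Unique.upTo⁺ (suc N)) (Unique.upTo⁺ (suc N)))

module UpperBound (N D : ℕ) {{_ : NonZero D}} where

  -- Below the threshold a pair is coded by itself. From it on, n, the label and the window k / D
  -- suffice, because `isolated` recovers k.
  Code : Set
  Code = (Fin (threshold D) × Fin (suc N)) ⊎ (Fin (suc N) × (Label × Fin (suc (N ℕ./ D))))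

  Code-finite : FiniteSet Code
  Code-finite = ⊎-finite (×-finite≡ Fin-finite Fin-finite) (×-finite≡ Fin-finite (×-finite≡ Label-finite Fin-finite))

  record Entry (p : Pair) : Set where
    field
      n≤N   : proj₁ p ℕ.< suc N
      k≤N   : proj₂ p ℕ.< suc N
      label : Label
      holds : Holds (proj₁ p) (proj₂ p) label
  open Entry

  entry : ∀ {p} → p ∈ filter cayley? (pairsUpTo N) → Entry p
  entry {n , k} p∈ with ∈-filter⁻ cayley? {xs = pairsUpTo N} p∈
  ... | p∈′ , cay with ∈-pairsUpTo⁻ N p∈′
  ...   | n≤N , k≤N , 3≤n , _ = record { n≤N = n≤N ; k≤N = k≤N ; label = proj₁ lab ; holds = proj₂ lab }
    where
    lab : ∃[ ℓ ] Holds n k ℓ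
    lab = Cayley⇒Holds n k {{ℕ.>-nonZero (ℕ.≤-trans (s≤s z≤n) 3≤n)}} cay

  window : ∀ {p} → Entry p → proj₂ p ℕ./ D ℕ.< suc (N ℕ./ D)
  window e = s≤s (/-monoˡ-≤ D (ℕ.s≤s⁻¹ (k≤N e)))

  encode : ∀ {p} → Entry p → Dec (proj₁ p ℕ.< threshold D) → Code
  encode e (yes n<) = inj₁ (fromℕ< n< , fromℕ< (k≤N e))
  encode e (no _)   = inj₂ (fromℕ< (n≤N e) , label e , fromℕ< (window e))

  fromℕ<-injective : ∀ {m n o} (m<o : m ℕ.< o) (n<o : n ℕ.< o) → fromℕ< m<o ≡ fromℕ< n<o → m ≡ n
  fromℕ<-injective m<o n<o eq = trans (sym (toℕ-fromℕ< m<o)) (trans (cong toℕ eq) (toℕ-fromℕ< n<o))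

  same-order : ∀ {n k k′} → threshold D ℕ.≤ n → k ℕ./ D ≡ k′ ℕ./ D →
               (∃[ ℓ ] Holds n k ℓ × Holds n k′ ℓ) → k ≡ k′
  same-order {n} {k} {k′} large eq (ℓ , h , h′) = isolated large (same-window⇒close k k′ D eq) ℓ h h′

  encode-injective : ∀ {p q} (e : Entry p) (f : Entry q) d d′ → encode e d ≡ encode f d′ → p ≡ q
  encode-injective e f (yes n<) (yes n<′) eq = cong₂ _,_
    (fromℕ<-injective n< n<′ (cong proj₁ (inj₁-injective eq)))
    (fromℕ<-injective (k≤N e) (k≤N f) (cong proj₂ (inj₁-injective eq)))
  encode-injective {n , k} {n′ , k′} e f (no n≮) (no _) eq = conclude n≡n′ e f
      (cong (λ c → proj₁ (proj₂ c)) (inj₂-injective eq))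
      (fromℕ<-injective (window e) (window f) (cong (λ c → proj₂ (proj₂ c)) (inj₂-injective eq)))
    where
    n≡n′ : n ≡ n′
    n≡n′ = fromℕ<-injective (n≤N e) (n≤N f) (cong proj₁ (inj₂-injective eq))
    conclude : n ≡ n′ → (e : Entry (n , k)) (f : Entry (n′ , k′)) →
               label e ≡ label f → k ℕ./ D ≡ k′ ℕ./ D → (n , k) ≡ (n′ , k′)
    conclude refl e f ℓ≡ w≡ = cong (n ,_) (same-order (ℕ.≮⇒≥ n≮) w≡
      (label e , holds e , subst (Holds n k′) (sym ℓ≡) (holds f)))

  -- Removing duplicates only shortens the list, so it is enough to count pairs instead of classes.
  bound : B N ℕ.≤ threshold D ℕ.* suc N ℕ.+ suc N ℕ.* (#labels ℕ.* suc (N ℕ./ D))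
  bound = subst (λ C → B N ℕ.≤ threshold D ℕ.* suc N ℕ.+ suc N ℕ.* (C ℕ.* suc (N ℕ./ D))) #labels-def
    (ℕ.≤-trans (length-deduplicate _≃?_ (filter cayley? (pairsUpTo N)))
      (length≤size (Unique.filter⁺ cayley? (pairsUpTo-unique N)) Code-finite
        (λ {p} p∈ → encode (entry p∈) (proj₁ p ℕ.<? threshold D))
        (λ {p} {q} p∈ q∈ → encode-injective (entry p∈) (entry q∈) (proj₁ p ℕ.<? threshold D) (proj₁ q ℕ.<? threshold D))))

-- Each `g i` is similar to some representative that survives; two of them sharing a representative
-- would be similar to each other.
size≤#classes : ∀ {m} xs (g : Fin m → Pair) → (∀ i → g i ∈ xs) →
                (∀ i j → Similarity (g i) (g j) → i ≡ j) → m ℕ.≤ #classes xs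
size≤#classes {m} xs g g∈ separated = injective⇒≤ {f = λ i → Any.index (representative i)} λ {i} {j} eq →
  separated i j (Similarity-trans (Similarity-sym (Any.lookup-index (representative i)))
    (subst (λ r → Similarity (lookup reps r) (g j)) (sym eq) (Any.lookup-index (representative j))))
  where
  reps = deduplicate _≃?_ xs
  representative : ∀ i → Any (λ q → Similarity q (g i)) reps
  representative i = Any.deduplicate⁺ _≃?_ (λ r≃q φ → Similarity-trans (≃⇒Similarity r≃q) φ)
    (Any.map (λ { refl → Similarity-refl }) (g∈ i))

-- Since |α + β k| ≤ 8 + 8 k < n, the congruence is an equation in ℤ. Then |α| = |β| k, which
-- exceeds 8 unless β = 0.
generic-range : ∀ {n k} → 8 ℕ.< k → 8 ℕ.+ 8 ℕ.* k ℕ.< n → Generic n k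
generic-range {n} {k} 8<k 8+8k<n α β α≤8 β≤8 n∣ with β ℤ.≟ 0ℤ
... | yes refl = trans (sym (ℤ.+-identityʳ α)) α+βk≡0 , refl
  where
  α+βk≡0 : α ℤ.+ 0ℤ ≡ 0ℤ
  α+βk≡0 = multiple-below⇒0 n∣ (ℕ.≤-<-trans (ℤ.∣i+j∣≤∣i∣+∣j∣ α 0ℤ)
    (ℕ.≤-<-trans (ℕ.+-mono-≤ α≤8 z≤n) 8+8k<n))
... | no β≢0 = contradiction k≤8 (ℕ.<⇒≱ 8<k)
  where
  ∣βk∣ : ℤ.∣ β ℤ.* + k ∣ ≡ ℤ.∣ β ∣ ℕ.* k
  ∣βk∣ = ℤ.abs-* β (+ k)
  α+βk≡0 : α ℤ.+ β ℤ.* + k ≡ 0ℤ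
  α+βk≡0 = multiple-below⇒0 n∣ (ℕ.≤-<-trans (ℤ.∣i+j∣≤∣i∣+∣j∣ α (β ℤ.* + k))
    (ℕ.≤-<-trans (ℕ.+-mono-≤ α≤8 (subst (ℕ._≤ 8 ℕ.* k) (sym ∣βk∣) (ℕ.*-monoˡ-≤ k β≤8))) 8+8k<n))
  ∣α∣≡∣β∣k : ℤ.∣ α ∣ ≡ ℤ.∣ β ∣ ℕ.* k
  ∣α∣≡∣β∣k = trans (cong ℤ.∣_∣ (ℤ.i-j≡0⇒i≡j α (ℤ.- (β ℤ.* + k))
    (trans (cong (λ z → α ℤ.+ z) (ℤ.neg-involutive (β ℤ.* + k))) α+βk≡0)))
    (trans (ℤ.∣-i∣≡∣i∣ (β ℤ.* + k)) ∣βk∣)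
  k≤8 : k ℕ.≤ 8
  k≤8 = ℕ.≤-trans (ℕ.m≤n*m k ℤ.∣ β ∣ {{ℕ.≢-nonZero (λ eq → β≢0 (ℤ.∣i∣≡0⇒i≡0 eq))}})
                  (subst (ℕ._≤ 8) ∣α∣≡∣β∣k α≤8)

-- Both n and k are even, so k k′ ≡ ±1 (mod n) never happens; n > 8 k + 8 makes (n , k) generic.
module LowerBound (N T : ℕ) (18T+74≤N : 18 ℕ.* T ℕ.+ 74 ℕ.≤ N) where

  -- Steps run through the even numbers from 10 to 2 T + 8, so 8 + 8 k is at most 16 T + 72; orders
  -- start at the next even number, 16 T + 74.
  order : Fin T → ℕ
  order m = 2 ℕ.* (8 ℕ.* T ℕ.+ 37 ℕ.+ toℕ m)

  step : Fin T → ℕ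
  step j = 2 ℕ.* (5 ℕ.+ toℕ j)

  module _ (m j : Fin T) where
    open ℕ.≤-Reasoning

    8+8k<n : 8 ℕ.+ 8 ℕ.* step j ℕ.< order m
    8+8k<n = begin-strict
      8 ℕ.+ 8 ℕ.* step j                    ≡⟨ lem₁ (toℕ j) ⟩
      16 ℕ.* suc (toℕ j) ℕ.+ 72             ≤⟨ ℕ.+-monoˡ-≤ 72 (ℕ.*-monoʳ-≤ 16 (toℕ<n j)) ⟩
      16 ℕ.* T ℕ.+ 72                       <⟨ ℕ.m<m+n _ (s≤s z≤n) ⟩
      16 ℕ.* T ℕ.+ 72 ℕ.+ 2                 ≤⟨ ℕ.m≤m+n _ _ ⟩
      16 ℕ.* T ℕ.+ 72 ℕ.+ 2 ℕ.+ 2 ℕ.* toℕ m ≡⟨ lem₂ T (toℕ m) ⟩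
      order m                               ∎
      where
      lem₁ : ∀ j → 8 ℕ.+ 8 ℕ.* (2 ℕ.* (5 ℕ.+ j)) ≡ 16 ℕ.* suc j ℕ.+ 72
      lem₁ = ℕ-Solver.solve-∀
      lem₂ : ∀ T m → 16 ℕ.* T ℕ.+ 72 ℕ.+ 2 ℕ.+ 2 ℕ.* m ≡ 2 ℕ.* (8 ℕ.* T ℕ.+ 37 ℕ.+ m)
      lem₂ = ℕ-Solver.solve-∀

    order≤N : order m ℕ.≤ N
    order≤N = begin
      order m                                      ≤⟨ ℕ.*-monoʳ-≤ 2 (ℕ.+-monoʳ-≤ (8 ℕ.* T ℕ.+ 37) (ℕ.<⇒≤ (toℕ<n m))) ⟩
      2 ℕ.* (8 ℕ.* T ℕ.+ 37 ℕ.+ T)                 ≡⟨ lem T ⟩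
      18 ℕ.* T ℕ.+ 74                              ≤⟨ 18T+74≤N ⟩
      N                                            ∎
      where
      lem : ∀ T → 2 ℕ.* (8 ℕ.* T ℕ.+ 37 ℕ.+ T) ≡ 18 ℕ.* T ℕ.+ 74
      lem = ℕ-Solver.solve-∀

    8<step : 8 ℕ.< step j
    8<step = ℕ.≤-trans (from-yes (9 ℕ.≤? 10)) (ℕ.*-monoʳ-≤ 2 (ℕ.m≤m+n 5 (toℕ j)))

    2*step<order : 2 ℕ.* step j ℕ.< order m
    2*step<order = ℕ.≤-<-trans (ℕ.*-monoˡ-≤ (step j) (from-yes (2 ℕ.≤? 8))) (ℕ.≤-<-trans (ℕ.m≤n+m (8 ℕ.* step j) 8) 8+8k<n)

    pair : Pair
    pair = order m , step j

    pair∈ : pair ∈ pairsUpTo N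
    pair∈ = ∈-pairsUpTo⁺ N order≤N
      ( ℕ.≤-trans (ℕ.≤-trans (from-yes (3 ℕ.≤? 8)) (ℕ.m≤m+n 8 (8 ℕ.* step j))) (ℕ.<⇒≤ 8+8k<n)
      , ℕ.≤-trans (s≤s z≤n) 8<step
      , ℕ.<⇒≤ 2*step<order )

  order-injective : ∀ {m m′} → order m ≡ order m′ → m ≡ m′
  order-injective {m} {m′} eq = toℕ-injective (ℕ.+-cancelˡ-≡ (8 ℕ.* T ℕ.+ 37) (toℕ m) (toℕ m′)
    (ℕ.*-cancelˡ-≡ (8 ℕ.* T ℕ.+ 37 ℕ.+ toℕ m) (8 ℕ.* T ℕ.+ 37 ℕ.+ toℕ m′) 2 eq))

  step-injective : ∀ {j j′} → step j ≡ step j′ → j ≡ j′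
  step-injective {j} {j′} eq = toℕ-injective (ℕ.+-cancelˡ-≡ 5 (toℕ j) (toℕ j′) (ℕ.*-cancelˡ-≡ (5 ℕ.+ toℕ j) (5 ℕ.+ toℕ j′) 2 eq))

  similar⇒≡ : ∀ m j m′ j′ → Similarity (pair m j) (pair m′ j′) → m ≡ m′ × j ≡ j′
  similar⇒≡ m j m′ j′ φ with order-injective {m} {m′} (Similarity⇒order-≡ φ)
  ... | refl = refl , step-injective (similar-even⇒≡ (order m) {{order-nonZero}}
      (generic-range (8<step m j) (8+8k<n m j)) (ℕ.m∣m*n (8 ℕ.* T ℕ.+ 37 ℕ.+ toℕ m)) (ℕ.m∣m*n (5 ℕ.+ toℕ j))
      (ℕ.≤-trans (s≤s z≤n) (8<step m j)) (2*step<order m j) (2*step<order m j′) φ)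
    where
    order-nonZero : NonZero (order m)
    order-nonZero = ℕ.>-nonZero (ℕ.≤-<-trans z≤n (8+8k<n m j))

  pairAt : Fin (T ℕ.* T) → Pair
  pairAt i = let m , j = remQuot {T} T i in pair m j

  pairAt-separated : ∀ i i′ → Similarity (pairAt i) (pairAt i′) → i ≡ i′
  pairAt-separated i i′ φ =
    let m  , j  = remQuot {T} T i
        m′ , j′ = remQuot {T} T i′
        m≡m′ , j≡j′ = similar⇒≡ m j m′ j′ φ
    in trans (sym (combine-remQuot {T} T i)) (trans (cong₂ combine m≡m′ j≡j′) (combine-remQuot {T} T i′))

  bound : T ℕ.* T ℕ.≤ A N
  bound = size≤#classes (pairsUpTo N) pairAt
    (λ i → let m , j = remQuot {T} T i in pair∈ m j) pairAt-separated

-- Comparing the bounds on A and B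

-- Each of the two terms bounding q B stays within half of T²: the one linear in N because T is
-- large, the one of order N²/D because D is large. Scaling by 2 D clears the denominators.
quadratic-dominates : ∀ q D n₀ C e {T N W B} {{_ : NonZero D}} →
  suc N ≤ e ℕ.* T → W ℕ.* D ≤ suc e ℕ.* T → B ≤ n₀ ℕ.* suc N ℕ.+ suc N ℕ.* (C ℕ.* W) →
  2 ℕ.* (q ℕ.* (e ℕ.* C ℕ.* suc e)) ≤ D → 2 ℕ.* (q ℕ.* n₀ ℕ.* e) ℕ.< T → q ℕ.* B ℕ.< T ℕ.* T
quadratic-dominates q D n₀ C e {T} {N} {W} {B} {{D≢0}} N< W≤ B≤ D≥ T> =
  ℕ.*-cancelˡ-< (2 ℕ.* D) (q ℕ.* B) (T ℕ.* T) (begin-strict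
  2 ℕ.* D ℕ.* (q ℕ.* B)
    ≤⟨ ℕ.*-monoʳ-≤ (2 ℕ.* D) (ℕ.*-monoʳ-≤ q B≤) ⟩
  2 ℕ.* D ℕ.* (q ℕ.* (n₀ ℕ.* suc N ℕ.+ suc N ℕ.* (C ℕ.* W)))
    ≡⟨ lem₁ q D n₀ C (suc N) W ⟩
  2 ℕ.* (q ℕ.* n₀ ℕ.* D) ℕ.* suc N ℕ.+ 2 ℕ.* (q ℕ.* C) ℕ.* (suc N ℕ.* (W ℕ.* D))
    ≤⟨ ℕ.+-mono-≤ (ℕ.*-monoʳ-≤ (2 ℕ.* (q ℕ.* n₀ ℕ.* D)) N<) (ℕ.*-monoʳ-≤ (2 ℕ.* (q ℕ.* C)) (ℕ.*-mono-≤ N< W≤)) ⟩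
  2 ℕ.* (q ℕ.* n₀ ℕ.* D) ℕ.* (e ℕ.* T) ℕ.+ 2 ℕ.* (q ℕ.* C) ℕ.* (e ℕ.* T ℕ.* (suc e ℕ.* T))
    ≡⟨ lem₂ q D n₀ C e (suc e) T ⟩
  2 ℕ.* (q ℕ.* n₀ ℕ.* e) ℕ.* (D ℕ.* T) ℕ.+ 2 ℕ.* (q ℕ.* (e ℕ.* C ℕ.* suc e)) ℕ.* (T ℕ.* T)
    <⟨ ℕ.+-mono-<-≤ (ℕ.*-monoˡ-< (D ℕ.* T) {{DT≢0}} T>) (ℕ.*-monoˡ-≤ (T ℕ.* T) D≥) ⟩
  T ℕ.* (D ℕ.* T) ℕ.+ D ℕ.* (T ℕ.* T)
    ≡⟨ lem₃ D T ⟩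
  2 ℕ.* D ℕ.* (T ℕ.* T) ∎)
  where
  open ℕ.≤-Reasoning
  DT≢0 : NonZero (D ℕ.* T)
  DT≢0 = ℕ.m*n≢0 D T {{D≢0}} {{ℕ.>-nonZero (ℕ.≤-<-trans z≤n T>)}}
  lem₁ : ∀ q D n₀ C M W → 2 ℕ.* D ℕ.* (q ℕ.* (n₀ ℕ.* M ℕ.+ M ℕ.* (C ℕ.* W)))
                        ≡ 2 ℕ.* (q ℕ.* n₀ ℕ.* D) ℕ.* M ℕ.+ 2 ℕ.* (q ℕ.* C) ℕ.* (M ℕ.* (W ℕ.* D))
  lem₁ = ℕ-Solver.solve-∀
  lem₂ : ∀ q D n₀ C e f T → 2 ℕ.* (q ℕ.* n₀ ℕ.* D) ℕ.* (e ℕ.* T) ℕ.+ 2 ℕ.* (q ℕ.* C) ℕ.* (e ℕ.* T ℕ.* (f ℕ.* T))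
                          ≡ 2 ℕ.* (q ℕ.* n₀ ℕ.* e) ℕ.* (D ℕ.* T) ℕ.+ 2 ℕ.* (q ℕ.* (e ℕ.* C ℕ.* f)) ℕ.* (T ℕ.* T)
  lem₂ = ℕ-Solver.solve-∀
  lem₃ : ∀ D T → T ℕ.* (D ℕ.* T) ℕ.+ D ℕ.* (T ℕ.* T) ≡ 2 ℕ.* D ℕ.* (T ℕ.* T)
  lem₃ = ℕ-Solver.solve-∀

module _ (N D T : ℕ) {{_ : NonZero D}} (5≤T : 5 ≤ T) (D≤T : D ≤ T)
         (T36≤N : T ℕ.* 36 ≤ N) (N<[1+T]36 : N ℕ.< suc T ℕ.* 36) where
  open ℕ.≤-Reasoning

  18T+74≤N : 18 ℕ.* T ℕ.+ 74 ≤ N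
  18T+74≤N = begin
    18 ℕ.* T ℕ.+ 74         ≤⟨ ℕ.+-monoʳ-≤ (18 ℕ.* T) (ℕ.≤-trans (from-yes (74 ℕ.≤? 90)) (ℕ.*-monoʳ-≤ 18 5≤T)) ⟩
    18 ℕ.* T ℕ.+ 18 ℕ.* T   ≡⟨ ℕ.*-distribʳ-+ T 18 18 ⟨
    36 ℕ.* T                ≡⟨ ℕ.*-comm 36 T ⟩
    T ℕ.* 36                ≤⟨ T36≤N ⟩
    N                       ∎

  -- Here 45 = 36 + 9, where 9 T covers the remainder 36 for T ≥ 5. In the next lemma the extra
  -- window costs D ≤ T, hence 46.
  suc-N≤45T : suc N ≤ 45 ℕ.* T
  suc-N≤45T = begin
    suc N                   ≤⟨ N<[1+T]36 ⟩
    suc T ℕ.* 36            ≡⟨ ℕ.*-comm (suc T) 36 ⟩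
    36 ℕ.* suc T            ≡⟨ ℕ.*-suc 36 T ⟩
    36 ℕ.+ 36 ℕ.* T         ≤⟨ ℕ.+-monoˡ-≤ (36 ℕ.* T) (ℕ.≤-trans (from-yes (36 ℕ.≤? 45)) (ℕ.*-monoʳ-≤ 9 5≤T)) ⟩
    9 ℕ.* T ℕ.+ 36 ℕ.* T    ≡⟨ ℕ.*-distribʳ-+ T 9 36 ⟨
    45 ℕ.* T                ∎

  windows*D≤46T : suc (N ℕ./ D) ℕ.* D ≤ 46 ℕ.* T
  windows*D≤46T = begin
    D ℕ.+ N ℕ./ D ℕ.* D     ≤⟨ ℕ.+-mono-≤ D≤T (ℕ.≤-trans (m/n*n≤m N D) (ℕ.≤-trans (ℕ.n≤1+n N) suc-N≤45T)) ⟩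
    T ℕ.+ 45 ℕ.* T          ∎

  B-negligible : ∀ q → 2 ℕ.* (q ℕ.* (45 ℕ.* #labels ℕ.* 46)) ≤ D →
                 2 ℕ.* (q ℕ.* threshold D ℕ.* 45) ℕ.< T → q ℕ.* B N ℕ.< A N
  B-negligible q D≥ T> = ℕ.<-≤-trans
    (quadratic-dominates q D (threshold D) #labels 45 {T} {N} {suc (N ℕ./ D)} {B N}
      suc-N≤45T windows*D≤46T (UpperBound.bound N D) D≥ T>)
    (LowerBound.bound N T 18T+74≤N)

m<[1+m/n]*n : ∀ m n {{_ : NonZero n}} → m ℕ.< suc (m ℕ./ n) ℕ.* n
m<[1+m/n]*n m n = subst (ℕ._< suc (m ℕ./ n) ℕ.* n) (sym (m≡m%n+[m/n]*n m n)) (ℕ.+-monoˡ-< (m ℕ./ n ℕ.* n) (m%n<n m n))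

B<A-eventually : ∀ q D T₀ {{_ : NonZero D}} → 2 ℕ.* (q ℕ.* (45 ℕ.* #labels ℕ.* 46)) ≤ D →
                 5 ≤ T₀ → D ≤ T₀ → 2 ℕ.* (q ℕ.* threshold D ℕ.* 45) ℕ.< T₀ →
                 ∀ N → T₀ ℕ.* 36 ≤ N → q ℕ.* B N ℕ.< A N
B<A-eventually q D T₀ D≥ 5≤T₀ D≤T₀ T₀> N N≥ =
  B-negligible N D (N ℕ./ 36) (ℕ.≤-trans 5≤T₀ T₀≤T) (ℕ.≤-trans D≤T₀ T₀≤T)
    (m/n*n≤m N 36) (m<[1+m/n]*n N 36) q D≥ (ℕ.<-≤-trans T₀> T₀≤T)
  where
  T₀≤T : T₀ ≤ N ℕ./ 36
  T₀≤T = subst (_≤ N ℕ./ 36) (m*n/n≡m T₀ 36) (/-monoˡ-≤ 36 N≥)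

B/A→0 : ∀ q → ∃[ N₀ ] ∀ N → N₀ ≤ N → q ℕ.* B N ℕ.< A N
-- D is fixed from q first and N₀ chosen afterwards, since the threshold depends on D. The successor
-- makes D nonzero even for q = 0.
B/A→0 q = with-window (suc D₀) (ℕ.n≤1+n D₀)
  where
  D₀ : ℕ
  D₀ = 2 ℕ.* (q ℕ.* (45 ℕ.* #labels ℕ.* 46))

  with-window : ∀ D {{_ : NonZero D}} → D₀ ≤ D → ∃[ N₀ ] ∀ N → N₀ ≤ N → q ℕ.* B N ℕ.< A N
  with-window D D₀≤D = T₀ ℕ.* 36 , B<A-eventually q D T₀ D₀≤D
      (ℕ.m≤m+n 5 (D ℕ.+ suc M))
      (ℕ.≤-trans (ℕ.m≤m+n D (suc M)) (ℕ.m≤n+m (D ℕ.+ suc M) 5))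
      (ℕ.≤-trans (ℕ.m≤n+m (suc M) D) (ℕ.m≤n+m (D ℕ.+ suc M) 5))
    where
    -- T₀ adds up the three lower bounds required of T; `suc M` serves the strict one.
    M T₀ : ℕ
    M  = 2 ℕ.* (q ℕ.* threshold D ℕ.* 45)
    T₀ = 5 ℕ.+ (D ℕ.+ suc M)

-- A positive ε has numerator at least 1, so ε is at least the reciprocal of its denominator.
m/n<ε : ∀ (ε : ℚ) → 0ℚ < ε → ∀ m n {{n≢0 : NonZero n}} → ℚ.↧ₙ ε ℕ.* m ℕ.< n →
        ∣ (+ m) / n - 0ℚ ∣ < ε
m/n<ε ε@(mkℚ (+ zero) d c)     (*<* (ℤ.+<+ ())) m n qm<n
m/n<ε ε@(mkℚ ℤ.-[1+ p ] d c)   (*<* ()) m n qm<n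
m/n<ε ε@(mkℚ (+ suc p) d c) _ m n@(suc n′) qm<n = subst (_< ε)
  (sym (trans (cong ∣_∣ (ℚ.+-identityʳ ((+ m) / n))) (ℚ.0≤p⇒∣p∣≡p (ℚ.nonNegative⁻¹ _ {{ℚ.normalize-nonNeg m n}}))))
  (ℚ.toℚᵘ-cancel-< (ℚᵘ.<-respˡ-≃ (ℚᵘ.≃-sym (ℚ.toℚᵘ-fromℚᵘ (ℚᵘ.mkℚᵘ (+ m) n′)))
    (ℚᵘ.*<* (subst₂ ℤ._<_ (ℤ.pos-* m (suc d)) (ℤ.pos-* (suc p) n) (ℤ.+<+ m*q<p*n)))))
  where
  m*q<p*n : m ℕ.* suc d ℕ.< suc p ℕ.* n
  m*q<p*n = ℕ.<-≤-trans (subst (ℕ._< n) (ℕ.*-comm (suc d) m) qm<n) (ℕ.m≤n*m n (suc p))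

theorem1p3 : ∀ (ε : ℚ) → 0ℚ < ε →
    ∃[ N₀ ] ∀ (N : ℕ) → N₀ ≤ N →
    Σ[ A≢0 ∈ NonZero (A N) ] ∣ ((+ B N) / A N) {{A≢0}} - 0ℚ ∣ < ε
theorem1p3 ε 0<ε = proj₁ eventually , λ N N₀≤N → conclude (B N) (A N) (proj₂ eventually N N₀≤N)
  where
  eventually : ∃[ N₀ ] ∀ N → N₀ ≤ N → ℚ.↧ₙ ε ℕ.* B N ℕ.< A N
  eventually = B/A→0 (ℚ.↧ₙ ε)
  conclude : ∀ m n → ℚ.↧ₙ ε ℕ.* m ℕ.< n → Σ[ n≢0 ∈ NonZero n ] ∣ ((+ m) / n) {{n≢0}} - 0ℚ ∣ < ε
  conclude m n qm<n = n≢0 , m/n<ε ε 0<ε m n {{n≢0}} qm<n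
    where
    n≢0 : NonZero n
    n≢0 = ℕ.>-nonZero (ℕ.≤-<-trans z≤n qm<n)
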